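{- Let $a_{ -1}=1,a_0,\dots,a_l$ be fixed complex constants and set $f(u)=\sum_{i=-1}^{l}a_iu^i$. Suppose that the elements $h^{(p)}_k\in B$ satisfy the recurrence $$h^{(p)}_k=\sum_{i=-1}^{l}a_i\,h^{(p-1)}_{k-i}\qquad (k,p\in\mathbb Z).$$ Then for every $m\in\mathbb Z$ the generating functions $\Psi(u,m)=\sum_{k\in\mathbb Z}\psi_k|_{\mathcal B^{(m)}}u^k$ and $\Psi^*(u,m)=\sum_{k\in\mathbb Z}\psi^*_k|_{\mathcal B^{(m)}}u^{ -k}$ are given by $$\Psi(u,m)=u^{m+1}z\,H(u)\,DE(-f(u)),$$ $$\Psi^*(u,m)=u^{ -m+1}z^{ -1}\,E(-u^{ -1})\,DH(f(u)^{ -1}),$$ where $H(u)=\sum_{k\in\mathbb Z}h^{(0)}_ku^k$, $E(u)=\sum_{k\in\mathbb Z}e^{(0)}_ku^k$, $DE(u)=\sum_{p\in\mathbb Z}D_pu^p$ and $DH(u)=\sum_{p\in\mathbb Z}D^{(p)}u^p$.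
   Context: Setting. Let $B=\mathbb C[h^{(0)}_1,h^{(0)}_2,\dots]$ be the polynomial ring in independent variables $h^{(0)}_k$ ($k>0$), with $h^{(0)}_0=1$ and $h^{(0)}_k=0$ for $k<0$. $B$ is graded by $\deg h^{(0)}_n=n$, and $B^{\le n}$ is the sum of the homogeneous components of degree $\le n$. Let $\{h^{(r)}_k\}_{k,r\in\mathbb Z}$ be a family of elements of $B$ (extending the $h^{(0)}_k$) with $h^{(r)}_k\in B^{\le k+r}$, $h^{(k)}_{ -k}=1$ for all $k\in\mathbb Z$, and $h^{(r)}_k=0$ whenever $k+r<0$. For an integer vector $\lambda=(\lambda_1,\dots,\lambda_n)$ (parts may be negative and in any order), extended by $\lambda_i=0$ for $i>n$, let $s_\lambda\in B$ be the stable value, for large $N$, of $\det\left[h^{(j-1)}_{\lambda_i-i+1}\right]_{1\le i,j\le N}$ (the same for all $N\ge n$). It is required that $\{s_\lambda\}$, $\lambda$ ranging over all partitions, is a linear basis of $B$. Generalized elementary symmetric functions: for $a,p\in\mathbb Z$, $e^{(p)}_a=0$ if $p<a$, $e^{(p)}_a=1$ if $p=a$, and $e^{(p)}_a=\det\left[h^{(-p+j)}_{p+1-i}\right]_{1\le i,j\le p-a}$ if $p>a$. Let $z$ be a variable, $\mathcal B^{(m)}=z^mB$, $\mathcal B=\bigoplus_{m\in\mathbb Z}\mathcal B^{(m)}=B[z,z^{ -1}]$. Linear operators $\psi_k,\psi_k^*$ ($k\in\mathbb Z$) on $\mathcal B$ are defined on the basis $\{s_\lambda z^m\}$ ($\lambda$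 a partition, $m\in\mathbb Z$) by $$\psi_k(s_\lambda z^m)=s_{(k-m-1,\lambda_1,\lambda_2,\dots)}z^{m+1},$$ $$\psi^*_k(s_\lambda z^m)=\sum_{t=1}^\infty(-1)^{t+1}\delta_{k-m-1,\,\lambda_t-t}\;s_{(\lambda_1+1,\dots,\lambda_{t-1}+1,\lambda_{t+1},\lambda_{t+2},\dots)}z^{m-1}.$$ Linear operators $D_p$ and $D^{(p)}$ ($p\in\mathbb Z$) on $B$ are defined on $s_\lambda$, $\lambda=(\lambda_1\ge\dots\ge\lambda_n\ge0)$ a partition, by $$D_p(s_\lambda)=\det\left[h^{(j)}_{\lambda_i-i}\right]_{i=1,\dots,n;\;j=0,1,\dots,\widehat p,\dots,n}\ \text{ if }0\le p\le n,\qquad D_p(s_\lambda)=0\ \text{ otherwise}$$ (the column $j=p$ is omitted), and $$D^{(p)}(s_\lambda)=\sum_{t=1}^\infty(-1)^{t+1}h^{(p)}_{\lambda_t-t+2}\,s_{(\lambda_1+1,\dots,\lambda_{t-1}+1,\lambda_{t+1},\lambda_{t+2},\dots)},$$ where $\lambda_t=0$ for $t>n$ (a finite sum). They are extended to $\mathcal B$ by commuting with $z^{\pm1}$. For each fixed element of $B$ only finitely many $D_p$ and finitely many $D^{(p)}$ are nonzero on it ($D_p=0$ for $p<0$, $D^{(p)}=0$ for $p\ge0$, $D^{(p)}(s_\lambda)=0$ for $-p>\lambda_1+1$). Elements of $B$ act by multiplication, after the operators $D_p,D^{(p)}$; $DE(-f(u))=\sum_{p\ge0}(-f(u))^pD_p$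 and $DH(f(u)^{ -1})=\sum_{p>0}f(u)^pD^{(-p)}$. The identities are identities of formal series in $u^{\pm1}$. -}

module Defs where

open import Algebra.Bundles using (Ring; CommutativeRing)
open import Algebra.Module.Bundles using (LeftModule)
import Algebra.Definitions.RawMonoid as RawMonoidSum
import Algebra.Properties.Semiring.Exp as SemiringExp
import Algebra.Module.Construct.TensorUnit as TensorUnit
open import Algebra.Module.Morphism.Structures using (module LeftModuleMorphisms)
open import Data.Fin.Base using (Fin; zero; suc; toℕ; punchIn)
open import Data.Integer.Base as ℤ using (ℤ; +_; -[1+_]; 1ℤ)
import Data.Integer.Properties as ℤ
open import Data.List.Base as List using (List; []; _∷_; _++_; length; lookup)
open import Data.List.Relation.Unary.All using (All)
open import Data.List.Relation.Unary.Linked using (Linked)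
open import Data.List.Relation.Unary.Unique.Propositional using (Unique)
open import Data.Nat.Base as ℕ using (ℕ; zero; suc)
open import Data.Nat.ListAction using (sum)
import Data.Nat.Properties as ℕ
open import Data.Product.Base using (∃; _×_; _,_; proj₁; proj₂; map₁; map₂)
open import Data.Rational.Base as ℚ using (ℚ; 0ℚ; 1ℚ)
import Data.Rational.Properties as ℚ
import Data.Rational.Solver as ℚ-Solver
open import Data.Sum.Base using (_⊎_; inj₁; inj₂)
open import Level using (_⊔_; 0ℓ)
open import Relation.Binary.PropositionalEquality
  using (_≡_; refl; sym; trans; cong; subst)
open import Relation.Nullary using (¬_; yes; no)

-- The complex numbers: ℝ is the ring of Cauchy sequences of rationals
-- modulo null sequences (as a setoid), and ℂ = ℝ[i].

module ComplexNumbers where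

  -- d m n → 0 as m, n → ∞ independently.
  Vanishing : (ℕ → ℕ → ℚ) → Set
  Vanishing d = ∀ ε → 0ℚ ℚ.< ε →
    ∃ λ N → ∀ m n → N ℕ.≤ m → N ℕ.≤ n → ℚ.∣ d m n ∣ ℚ.< ε

  Seq : Set
  Seq = ℕ → ℚ

  infix 4 _~_

  -- For Cauchy sequences this says that x n - y n → 0; also, x ~ x says
  -- exactly that x is a Cauchy sequence.
  _~_ : Seq → Seq → Set
  x ~ y = Vanishing (λ m n → x m ℚ.- y n)

  record ℝ : Set where
    no-eta-equality
    field
      seq    : Seq
      cauchy : seq ~ seq

  open ℝ public

  infix 4 _≈ℝ_

  record _≈ℝ_ (x y : ℝ) : Set where
    constructor mk≈
    field
      un≈ : seq x ~ seq y

  open _≈ℝ_ public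

  private
    open ℚ-Solver.+-*-Solver

    half-< : ∀ {ε} → 0ℚ ℚ.< ε → 0ℚ ℚ.< ε ℚ.* ℚ.½
    half-< {ε} 0<ε =
      subst (ℚ._< ε ℚ.* ℚ.½) (ℚ.*-zeroˡ ℚ.½) (ℚ.*-monoˡ-<-pos ℚ.½ 0<ε)

    halves : ∀ ε → ε ℚ.* ℚ.½ ℚ.+ ε ℚ.* ℚ.½ ≡ ε
    halves ε = trans (sym (ℚ.*-distribˡ-+ ε ℚ.½ ℚ.½)) (ℚ.*-identityʳ ε)

    Bounded : (ℕ → ℕ → ℚ) → Set
    Bounded c = ∃ λ M → 0ℚ ℚ.< M × (∀ m n → ℚ.∣ c m n ∣ ℚ.≤ M)

    van-cong : ∀ {d e} → (∀ m n → d m n ≡ e m n) → Vanishing d → Vanishing e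
    van-cong d≡e vd ε 0<ε =
      let N , p = vd ε 0<ε in
      N , λ m n N≤m N≤n →
        subst (λ q → ℚ.∣ q ∣ ℚ.< ε) (d≡e m n) (p m n N≤m N≤n)

    van-+ : ∀ {d e} → Vanishing d → Vanishing e →
            Vanishing (λ m n → d m n ℚ.+ e m n)
    van-+ {d} {e} vd ve ε 0<ε =
      let N , p = vd (ε ℚ.* ℚ.½) (half-< 0<ε)
          K , q = ve (ε ℚ.* ℚ.½) (half-< 0<ε)
      in N ℕ.⊔ K , λ m n N≤m N≤n →
        subst (ℚ.∣ d m n ℚ.+ e m n ∣ ℚ.<_) (halves ε)
          (ℚ.≤-<-trans (ℚ.∣p+q∣≤∣p∣+∣q∣ (d m n) (e m n))
            (ℚ.+-mono-<
              (p m n (ℕ.≤-trans (ℕ.m≤m⊔n N K) N≤m) (ℕ.≤-trans (ℕ.m≤m⊔n N K) N≤n))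
              (q m n (ℕ.≤-trans (ℕ.m≤n⊔m N K) N≤m) (ℕ.≤-trans (ℕ.m≤n⊔m N K) N≤n))))

    van-neg : ∀ {d} → Vanishing d → Vanishing (λ m n → ℚ.- d m n)
    van-neg {d} vd ε 0<ε =
      let N , p = vd ε 0<ε in
      N , λ m n N≤m N≤n →
        subst (ℚ._< ε) (sym (ℚ.∣-p∣≡∣p∣ (d m n))) (p m n N≤m N≤n)

    van-* : ∀ {c d} → Bounded c → Vanishing d →
            Vanishing (λ m n → c m n ℚ.* d m n)
    van-* {c} {d} (M , 0<M , c≤M) vd ε 0<ε =
      let N , p = vd (1/M ℚ.* ε) 0<ε/M in
      N , λ m n N≤m N≤n →
        subst (ℚ._< ε) (sym (ℚ.∣p*q∣≡∣p∣*∣q∣ (c m n) (d m n)))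
          (ℚ.≤-<-trans
            (ℚ.*-monoʳ-≤-nonNeg ℚ.∣ d m n ∣ {{ℚ.∣-∣-nonNeg (d m n)}} (c≤M m n))
            (subst (M ℚ.* ℚ.∣ d m n ∣ ℚ.<_) M*ε/M
              (ℚ.*-monoʳ-<-pos M {{M>0}} (p m n N≤m N≤n))))
      where
      M>0 : ℚ.Positive M
      M>0 = ℚ.positive 0<M
      instance
        M≢0 : ℚ.NonZero M
        M≢0 = ℚ.pos⇒nonZero M {{M>0}}
      1/M = ℚ.1/ M
      0<ε/M : 0ℚ ℚ.< 1/M ℚ.* ε
      0<ε/M = subst (ℚ._< 1/M ℚ.* ε) (ℚ.*-zeroʳ 1/M)
        (ℚ.*-monoʳ-<-pos 1/M {{ℚ.1/pos⇒pos M {{M>0}}}} 0<ε)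
      M*ε/M : M ℚ.* (1/M ℚ.* ε) ≡ ε
      M*ε/M = trans (sym (ℚ.*-assoc M 1/M ε))
        (trans (cong (ℚ._* ε) (ℚ.*-inverseʳ M)) (ℚ.*-identityˡ ε))

    prefixBound : Seq → ℕ → ℚ
    prefixBound x zero    = ℚ.∣ x 0 ∣
    prefixBound x (suc N) = prefixBound x N ℚ.+ ℚ.∣ x (suc N) ∣

    ≤-+ʳ : ∀ {p q} r → p ℚ.≤ q → p ℚ.≤ q ℚ.+ ℚ.∣ r ∣
    ≤-+ʳ {p} {q} r p≤q =
      subst (ℚ._≤ q ℚ.+ ℚ.∣ r ∣) (ℚ.+-identityʳ p) (ℚ.+-mono-≤ p≤q (ℚ.0≤∣p∣ r))

    prefixBound≥0 : ∀ x N → 0ℚ ℚ.≤ prefixBound x N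
    prefixBound≥0 x zero    = ℚ.0≤∣p∣ (x 0)
    prefixBound≥0 x (suc N) = ≤-+ʳ (x (suc N)) (prefixBound≥0 x N)

    last≤prefixBound : ∀ x N → ℚ.∣ x N ∣ ℚ.≤ prefixBound x N
    last≤prefixBound x zero    = ℚ.≤-refl
    last≤prefixBound x (suc N) =
      subst (ℚ._≤ prefixBound x (suc N)) (ℚ.+-identityˡ ℚ.∣ x (suc N) ∣)
        (ℚ.+-monoˡ-≤ ℚ.∣ x (suc N) ∣ (prefixBound≥0 x N))

    ≤prefixBound : ∀ x {n N} → n ℕ.≤′ N → ℚ.∣ x n ∣ ℚ.≤ prefixBound x N
    ≤prefixBound x {n} ℕ.≤′-refl            = last≤prefixBound x n
    ≤prefixBound x {n} (ℕ.≤′-step {N} n≤N) = ≤-+ʳ (x (suc N)) (≤prefixBound x n≤N)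

    0<1 : 0ℚ ℚ.< 1ℚ
    0<1 = ℚ.positive⁻¹ 1ℚ

    bounded : ∀ {x} → x ~ x → ∃ λ M → 0ℚ ℚ.< M × (∀ n → ℚ.∣ x n ∣ ℚ.≤ M)
    bounded {x} cx with cx 1ℚ 0<1
    ... | N , p = 1ℚ ℚ.+ prefixBound x N , 0<M , bound
      where
      0<M : 0ℚ ℚ.< 1ℚ ℚ.+ prefixBound x N
      0<M = ℚ.+-mono-<-≤ 0<1 (prefixBound≥0 x N)
      bound : ∀ n → ℚ.∣ x n ∣ ℚ.≤ 1ℚ ℚ.+ prefixBound x N
      bound n with ℕ.≤-total n N
      ... | inj₁ n≤N = ℚ.≤-trans (≤prefixBound x (ℕ.≤⇒≤′ n≤N))
              (subst (ℚ._≤ 1ℚ ℚ.+ prefixBound x N) (ℚ.+-identityˡ _)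
                (ℚ.+-monoˡ-≤ (prefixBound x N) (ℚ.<⇒≤ 0<1)))
      ... | inj₂ N≤n = ℚ.≤-trans
              (subst (λ q → ℚ.∣ q ∣ ℚ.≤ ℚ.∣ x n ℚ.- x N ∣ ℚ.+ ℚ.∣ x N ∣)
                (solve 2 (λ a b → (a :- b) :+ b := a) refl (x n) (x N))
                (ℚ.∣p+q∣≤∣p∣+∣q∣ (x n ℚ.- x N) (x N)))
              (ℚ.+-mono-≤ (ℚ.<⇒≤ (p n N N≤n ℕ.≤-refl)) (last≤prefixBound x N))

    ~-sym : ∀ {x y} → x ~ y → y ~ x
    ~-sym {x} {y} x~y ε 0<ε =
      let N , p = x~y ε 0<ε in
      N , λ m n N≤m N≤n →
        subst (ℚ._< ε)
          (trans (sym (ℚ.∣-p∣≡∣p∣ (x n ℚ.- y m)))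
            (cong ℚ.∣_∣ (solve 2 (λ a b → :- (a :- b) := b :- a) refl (x n) (y m))))
          (p n m N≤n N≤m)

    ~-trans : ∀ {x y z} → x ~ y → y ~ z → x ~ z
    ~-trans {x} {y} {z} x~y y~z ε 0<ε =
      let N , p = x~y (ε ℚ.* ℚ.½) (half-< 0<ε)
          K , q = y~z (ε ℚ.* ℚ.½) (half-< 0<ε)
          j = N ℕ.⊔ K
      in j , λ m n j≤m j≤n →
        subst (ℚ.∣ x m ℚ.- z n ∣ ℚ.<_) (halves ε)
          (ℚ.≤-<-trans
            (subst (λ r → ℚ.∣ r ∣ ℚ.≤ ℚ.∣ x m ℚ.- y j ∣ ℚ.+ ℚ.∣ y j ℚ.- z n ∣)
              (solve 3 (λ a b c → (a :- b) :+ (b :- c) := a :- c) refl (x m) (y j) (z n))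
              (ℚ.∣p+q∣≤∣p∣+∣q∣ (x m ℚ.- y j) (y j ℚ.- z n)))
            (ℚ.+-mono-<
              (p m j (ℕ.≤-trans (ℕ.m≤m⊔n N K) j≤m) (ℕ.m≤m⊔n N K))
              (q j n (ℕ.m≤n⊔m N K) (ℕ.≤-trans (ℕ.m≤n⊔m N K) j≤n))))

    +-~ : ∀ {x y u v} → x ~ y → u ~ v →
          (λ n → x n ℚ.+ u n) ~ (λ n → y n ℚ.+ v n)
    +-~ {x} {y} {u} {v} x~y u~v = van-cong
      (λ m n → solve 4 (λ a b c d → (a :- b) :+ (c :- d) := (a :+ c) :- (b :+ d))
        refl (x m) (y n) (u m) (v n))
      (van-+ x~y u~v)

    neg-~ : ∀ {x y} → x ~ y → (λ n → ℚ.- x n) ~ (λ n → ℚ.- y n)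
    neg-~ {x} {y} x~y = van-cong
      (λ m n → solve 2 (λ a b → :- (a :- b) := (:- a) :- (:- b)) refl (x m) (y n))
      (van-neg x~y)

    *-~ : ∀ {x y u v} → x ~ x → v ~ v → x ~ y → u ~ v →
          (λ n → x n ℚ.* u n) ~ (λ n → y n ℚ.* v n)
    *-~ {x} {y} {u} {v} cx cv x~y u~v =
      let M , 0<M , x≤M = bounded {x} cx
          L , 0<L , v≤L = bounded {v} cv
      in van-cong
        (λ m n → solve 4
          (λ a b c d → a :* (c :- d) :+ d :* (a :- b) := a :* c :- b :* d)
          refl (x m) (y n) (u m) (v n))
        (van-+ (van-* {λ m n → x m} (M , 0<M , λ m n → x≤M m) u~v)
               (van-* {λ m n → v n} (L , 0<L , λ m n → v≤L n) x~y))

    const-~ : ∀ q → (λ _ → q) ~ (λ _ → q)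
    const-~ q ε 0<ε = 0 , λ _ _ _ _ →
      subst (ℚ._< ε) (cong ℚ.∣_∣ (sym (ℚ.+-inverseʳ q))) 0<ε

  infixl 6 _+ℝ_
  infixl 7 _*ℝ_
  infix  8 -ℝ_

  _+ℝ_ _*ℝ_ : ℝ → ℝ → ℝ
  (x +ℝ y) .seq n  = seq x n ℚ.+ seq y n
  (x +ℝ y) .cauchy = +-~ {seq x} {seq x} {seq y} {seq y} (cauchy x) (cauchy y)
  (x *ℝ y) .seq n  = seq x n ℚ.* seq y n
  (x *ℝ y) .cauchy = *-~ {seq x} {seq x} {seq y} {seq y}
                       (cauchy x) (cauchy y) (cauchy x) (cauchy y)

  -ℝ_ : ℝ → ℝ
  (-ℝ x) .seq n  = ℚ.- seq x n
  (-ℝ x) .cauchy = neg-~ {seq x} {seq x} (cauchy x)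

  fromℚ : ℚ → ℝ
  fromℚ q .seq n  = q
  fromℚ q .cauchy = const-~ q

  private
    pointwise : ∀ x y → (∀ n → seq x n ≡ seq y n) → x ≈ℝ y
    pointwise x y x≡y =
      mk≈ (van-cong (λ m n → cong (λ q → seq x m ℚ.- q) (x≡y n)) (cauchy x))

  ℝ-commutativeRing : CommutativeRing 0ℓ 0ℓ
  ℝ-commutativeRing = record
    { Carrier = ℝ
    ; _≈_     = _≈ℝ_
    ; _+_     = _+ℝ_
    ; _*_     = _*ℝ_
    ; -_      = -ℝ_
    ; 0#      = fromℚ 0ℚ
    ; 1#      = fromℚ 1ℚ
    ; isCommutativeRing = record
      { isRing = record
        { +-isAbelianGroup = record
          { isGroup = record
            { isMonoid = record
              { isSemigroup = record
                { isMagma = record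
                  { isEquivalence = record
                    { refl  = λ {x} → mk≈ (cauchy x)
                    ; sym   = λ {x} {y} (mk≈ p) → mk≈ (~-sym {seq x} {seq y} p)
                    ; trans = λ {x} {y} {z} (mk≈ p) (mk≈ q) →
                        mk≈ (~-trans {seq x} {seq y} {seq z} p q)
                    }
                  ; ∙-cong = λ {x} {y} {u} {v} (mk≈ p) (mk≈ q) →
                      mk≈ (+-~ {seq x} {seq y} {seq u} {seq v} p q)
                  }
                ; assoc = λ x y z → pointwise ((x +ℝ y) +ℝ z) (x +ℝ (y +ℝ z))
                    (λ n → ℚ.+-assoc (seq x n) (seq y n) (seq z n))
                }
              ; identity =
                  (λ x → pointwise (fromℚ 0ℚ +ℝ x) x (λ n → ℚ.+-identityˡ (seq x n)))
                , (λ x → pointwise (x +ℝ fromℚ 0ℚ) x (λ n → ℚ.+-identityʳ (seq x n)))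
              }
            ; inverse =
                (λ x → pointwise (-ℝ x +ℝ x) (fromℚ 0ℚ) (λ n → ℚ.+-inverseˡ (seq x n)))
              , (λ x → pointwise (x +ℝ -ℝ x) (fromℚ 0ℚ) (λ n → ℚ.+-inverseʳ (seq x n)))
            ; ⁻¹-cong = λ {x} {y} (mk≈ p) → mk≈ (neg-~ {seq x} {seq y} p)
            }
          ; comm = λ x y → pointwise (x +ℝ y) (y +ℝ x)
              (λ n → ℚ.+-comm (seq x n) (seq y n))
          }
        ; *-cong = λ {x} {y} {u} {v} (mk≈ p) (mk≈ q) →
            mk≈ (*-~ {seq x} {seq y} {seq u} {seq v} (cauchy x) (cauchy v) p q)
        ; *-assoc = λ x y z → pointwise ((x *ℝ y) *ℝ z) (x *ℝ (y *ℝ z))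
            (λ n → ℚ.*-assoc (seq x n) (seq y n) (seq z n))
        ; *-identity =
            (λ x → pointwise (fromℚ 1ℚ *ℝ x) x (λ n → ℚ.*-identityˡ (seq x n)))
          , (λ x → pointwise (x *ℝ fromℚ 1ℚ) x (λ n → ℚ.*-identityʳ (seq x n)))
        ; distrib =
            (λ x y z → pointwise (x *ℝ (y +ℝ z)) (x *ℝ y +ℝ x *ℝ z)
              (λ n → ℚ.*-distribˡ-+ (seq x n) (seq y n) (seq z n)))
          , (λ x y z → pointwise ((y +ℝ z) *ℝ x) (y *ℝ x +ℝ z *ℝ x)
              (λ n → ℚ.*-distribʳ-+ (seq x n) (seq y n) (seq z n)))
        }
      ; *-comm = λ x y → pointwise (x *ℝ y) (y *ℝ x)
          (λ n → ℚ.*-comm (seq x n) (seq y n))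
      }
    }

  record ℂ : Set where
    no-eta-equality
    field
      re im : ℝ

  open ℂ public

  infix 4 _≈ℂ_

  record _≈ℂ_ (x y : ℂ) : Set where
    constructor _,_
    field
      re-≈ : re x ≈ℝ re y
      im-≈ : im x ≈ℝ im y

  infixl 6 _+ℂ_
  infixl 7 _*ℂ_
  infix  8 -ℂ_

  _+ℂ_ _*ℂ_ : ℂ → ℂ → ℂ
  (x +ℂ y) .re = re x +ℝ re y
  (x +ℂ y) .im = im x +ℝ im y
  (x *ℂ y) .re = re x *ℝ re y +ℝ -ℝ (im x *ℝ im y)
  (x *ℂ y) .im = re x *ℝ im y +ℝ im x *ℝ re y

  -ℂ_ : ℂ → ℂ
  (-ℂ x) .re = -ℝ re x
  (-ℂ x) .im = -ℝ im x

  0ℂ 1ℂ : ℂ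
  0ℂ .re = fromℚ 0ℚ
  0ℂ .im = fromℚ 0ℚ
  1ℂ .re = fromℚ 1ℚ
  1ℂ .im = fromℚ 0ℚ

  ℂ-commutativeRing : CommutativeRing 0ℓ 0ℓ
  ℂ-commutativeRing = record
    { Carrier = ℂ
    ; _≈_     = _≈ℂ_
    ; _+_     = _+ℂ_
    ; _*_     = _*ℂ_
    ; -_      = -ℂ_
    ; 0#      = 0ℂ
    ; 1#      = 1ℂ
    ; isCommutativeRing = record
      { isRing = record
        { +-isAbelianGroup = record
          { isGroup = record
            { isMonoid = record
              { isSemigroup = record
                { isMagma = record
                  { isEquivalence = record
                    { refl  = 𝐑.refl , 𝐑.refl
                    ; sym   = λ { (p , q) → 𝐑.sym p , 𝐑.sym q }
                    ; trans = λ { (p , q) (r , s) → 𝐑.trans p r , 𝐑.trans q s }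
                    }
                  ; ∙-cong = λ { (p , q) (r , s) → 𝐑.+-cong p r , 𝐑.+-cong q s }
                  }
                ; assoc = λ x y z → 𝐑.+-assoc (re x) (re y) (re z)
                                  , 𝐑.+-assoc (im x) (im y) (im z)
                }
              ; identity =
                  (λ x → 𝐑.+-identityˡ (re x) , 𝐑.+-identityˡ (im x))
                , (λ x → 𝐑.+-identityʳ (re x) , 𝐑.+-identityʳ (im x))
              }
            ; inverse =
                (λ x → 𝐑.-‿inverseˡ (re x) , 𝐑.-‿inverseˡ (im x))
              , (λ x → 𝐑.-‿inverseʳ (re x) , 𝐑.-‿inverseʳ (im x))
            ; ⁻¹-cong = λ { (p , q) → 𝐑.-‿cong p , 𝐑.-‿cong q }
            }
          ; comm = λ x y → 𝐑.+-comm (re x) (re y) , 𝐑.+-comm (im x) (im y)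
          }
        ; *-cong = λ { (p , q) (r , s) →
            𝐑.+-cong (𝐑.*-cong p r) (𝐑.-‿cong (𝐑.*-cong q s))
          , 𝐑.+-cong (𝐑.*-cong p s) (𝐑.*-cong q r) }
        ; *-assoc = *-assoc
        ; *-identity = *-identityˡ , *-identityʳ
        ; distrib = distribˡ , distribʳ
        }
      ; *-comm = *-comm
      }
    }
    where
    module 𝐑 = CommutativeRing ℝ-commutativeRing
    open ℚ-Solver.+-*-Solver

    pointwiseℂ : ∀ x y → (∀ n → seq (re x) n ≡ seq (re y) n) →
                 (∀ n → seq (im x) n ≡ seq (im y) n) → x ≈ℂ y
    pointwiseℂ x y p q = pointwise (re x) (re y) p , pointwise (im x) (im y) q

    *-assoc : ∀ x y z → (x *ℂ y) *ℂ z ≈ℂ x *ℂ (y *ℂ z)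
    *-assoc x y z = pointwiseℂ ((x *ℂ y) *ℂ z) (x *ℂ (y *ℂ z))
      (λ n → solve 6 (λ a b c d e f →
          (a :* c :+ :- (b :* d)) :* e :+ :- ((a :* d :+ b :* c) :* f)
        := a :* (c :* e :+ :- (d :* f)) :+ :- (b :* (c :* f :+ d :* e)))
        refl (seq (re x) n) (seq (im x) n) (seq (re y) n) (seq (im y) n)
             (seq (re z) n) (seq (im z) n))
      (λ n → solve 6 (λ a b c d e f →
          (a :* c :+ :- (b :* d)) :* f :+ (a :* d :+ b :* c) :* e
        := a :* (c :* f :+ d :* e) :+ b :* (c :* e :+ :- (d :* f)))
        refl (seq (re x) n) (seq (im x) n) (seq (re y) n) (seq (im y) n)
             (seq (re z) n) (seq (im z) n))

    *-comm : ∀ x y → x *ℂ y ≈ℂ y *ℂ x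
    *-comm x y = pointwiseℂ (x *ℂ y) (y *ℂ x)
      (λ n → solve 4 (λ a b c d →
          a :* c :+ :- (b :* d) := c :* a :+ :- (d :* b))
        refl (seq (re x) n) (seq (im x) n) (seq (re y) n) (seq (im y) n))
      (λ n → solve 4 (λ a b c d → a :* d :+ b :* c := c :* b :+ d :* a)
        refl (seq (re x) n) (seq (im x) n) (seq (re y) n) (seq (im y) n))

    *-identityˡ : ∀ x → 1ℂ *ℂ x ≈ℂ x
    *-identityˡ x = pointwiseℂ (1ℂ *ℂ x) x
      (λ n → solve 2 (λ a b →
          con 1ℚ :* a :+ :- (con 0ℚ :* b) := a) refl (seq (re x) n) (seq (im x) n))
      (λ n → solve 2 (λ a b →
          con 1ℚ :* b :+ con 0ℚ :* a := b) refl (seq (re x) n) (seq (im x) n))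

    *-identityʳ : ∀ x → x *ℂ 1ℂ ≈ℂ x
    *-identityʳ x = pointwiseℂ (x *ℂ 1ℂ) x
      (λ n → solve 2 (λ a b →
          a :* con 1ℚ :+ :- (b :* con 0ℚ) := a) refl (seq (re x) n) (seq (im x) n))
      (λ n → solve 2 (λ a b →
          a :* con 0ℚ :+ b :* con 1ℚ := b) refl (seq (re x) n) (seq (im x) n))

    distribˡ : ∀ x y z → x *ℂ (y +ℂ z) ≈ℂ x *ℂ y +ℂ x *ℂ z
    distribˡ x y z = pointwiseℂ (x *ℂ (y +ℂ z)) (x *ℂ y +ℂ x *ℂ z)
      (λ n → solve 6 (λ a b c d e f →
          a :* (c :+ e) :+ :- (b :* (d :+ f))
        := (a :* c :+ :- (b :* d)) :+ (a :* e :+ :- (b :* f)))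
        refl (seq (re x) n) (seq (im x) n) (seq (re y) n) (seq (im y) n)
             (seq (re z) n) (seq (im z) n))
      (λ n → solve 6 (λ a b c d e f →
          a :* (d :+ f) :+ b :* (c :+ e)
        := (a :* d :+ b :* c) :+ (a :* f :+ b :* e))
        refl (seq (re x) n) (seq (im x) n) (seq (re y) n) (seq (im y) n)
             (seq (re z) n) (seq (im z) n))

    distribʳ : ∀ x y z → (y +ℂ z) *ℂ x ≈ℂ y *ℂ x +ℂ z *ℂ x
    distribʳ x y z = pointwiseℂ ((y +ℂ z) *ℂ x) (y *ℂ x +ℂ z *ℂ x)
      (λ n → solve 6 (λ a b c d e f →
          (c :+ e) :* a :+ :- ((d :+ f) :* b)
        := (c :* a :+ :- (d :* b)) :+ (e :* a :+ :- (f :* b)))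
        refl (seq (re x) n) (seq (im x) n) (seq (re y) n) (seq (im y) n)
             (seq (re z) n) (seq (im z) n))
      (λ n → solve 6 (λ a b c d e f →
          (c :+ e) :* b :+ (d :+ f) :* a
        := (c :* b :+ d :* a) :+ (e :* b :+ f :* a))
        refl (seq (re x) n) (seq (im x) n) (seq (re y) n) (seq (im y) n)
             (seq (re z) n) (seq (im z) n))

open ComplexNumbers public using (ℂ; ℂ-commutativeRing)

module Determinant {r ℓr} (𝐑 : Ring r ℓr) where
  open Ring 𝐑 using (Carrier; _*_; -_; 1#; semiring; +-rawMonoid)
  open RawMonoidSum +-rawMonoid using () renaming (sum to ∑)
  open SemiringExp semiring using (_^_)

  -- Laplace expansion along the first row.
  det : ∀ {n} → (Fin n → Fin n → Carrier) → Carrier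
  det {zero}  A = 1#
  det {suc n} A = ∑ λ j →
    (- 1#) ^ toℕ j * A zero j * det (λ i k → A (suc i) (punchIn j k))

module Sums {r ℓr m ℓm} {𝐑 : Ring r ℓr} (M : LeftModule 𝐑 m ℓm) where
  open Ring 𝐑 using (0#) renaming (Carrier to R; _≈_ to _≈ᴿ_)
  open LeftModule M
  open RawMonoidSum +ᴹ-rawMonoid using () renaming (sum to ∑)

  -- x = Σ_{t ≥ 0} g t, all but finitely many terms being zero.
  IsSum : (ℕ → Carrierᴹ) → Carrierᴹ → Set ℓm
  IsSum g x = ∃ λ N →
    (∀ t → N ℕ.≤ t → g t ≈ᴹ 0ᴹ) × ∑ {N} (λ t → g (toℕ t)) ≈ᴹ x

  combination : ∀ {i} {I : Set i} → (I → Carrierᴹ) → List (R × I) → Carrierᴹ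
  combination v = List.foldr (λ (c , i) x → c *ₗ v i +ᴹ x) 0ᴹ

  record IsBasis {i} {I : Set i} (v : I → Carrierᴹ) : Set (r ⊔ ℓr ⊔ m ⊔ ℓm ⊔ i) where
    field
      spans       : ∀ x → ∃ λ cs → combination v cs ≈ᴹ x
      independent : ∀ cs → Unique (List.map proj₂ cs) →
                    combination v cs ≈ᴹ 0ᴹ → All (λ (c , _) → c ≈ᴿ 0#) cs

module Laurent {r ℓr m ℓm} {𝐑 : Ring r ℓr} (M : LeftModule 𝐑 m ℓm) where
  private
    module 𝐑 = Ring 𝐑
    module M = LeftModule M
  open LeftModule M using (Carrierᴹ; 0ᴹ; _+ᴹ_; _*ₗ_; -ᴹ_; _≈ᴹ_)

  -- The list of (nᵢ , xᵢ) stands for Σᵢ xᵢ uⁿⁱ; exponents may repeat.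
  LPoly : Set m
  LPoly = List (ℤ × Carrierᴹ)

  coeff : LPoly → ℤ → Carrierᴹ
  coeff []             k = 0ᴹ
  coeff ((n , x) ∷ xs) k with n ℤ.≟ k
  ... | yes _ = x +ᴹ coeff xs k
  ... | no  _ = coeff xs k

  infix 4 _≈ᴸ_

  _≈ᴸ_ : LPoly → LPoly → Set ℓm
  xs ≈ᴸ ys = ∀ k → coeff xs k ≈ᴹ coeff ys k

  scale : 𝐑.Carrier → LPoly → LPoly
  scale c = List.map (map₂ (c *ₗ_))

  negate : LPoly → LPoly
  negate = List.map (map₂ -ᴹ_)

  -- Multiplication by uᵈ.
  shift : ℤ → LPoly → LPoly
  shift d = List.map (map₁ (λ n → d ℤ.+ n))

  constant : Carrierᴹ → LPoly
  constant x = (+ 0 , x) ∷ []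

  infixr 7 _⊛_ _⊙_

  -- Product with a Laurent polynomial over the scalars.
  _⊛_ : List (ℤ × 𝐑.Carrier) → LPoly → LPoly
  cs ⊛ xs = List.cartesianProductWith (λ (i , c) (n , x) → i ℤ.+ n , c *ₗ x) cs xs

  -- Product with a formal series (infinite in both directions) over the
  -- scalars.
  _⊙_ : (ℤ → 𝐑.Carrier) → LPoly → (ℤ → Carrierᴹ)
  (F ⊙ xs) k = List.foldr (λ (n , x) y → F (k ℤ.- n) *ₗ x +ᴹ y) 0ᴹ xs

  private
    coeff-++ : ∀ xs ys k → coeff (xs ++ ys) k ≈ᴹ coeff xs k +ᴹ coeff ys k
    coeff-++ []             ys k = M.≈ᴹ-sym (M.+ᴹ-identityˡ _)
    coeff-++ ((n , x) ∷ xs) ys k with n ℤ.≟ k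
    ... | yes _ = M.≈ᴹ-trans (M.+ᴹ-congˡ (coeff-++ xs ys k)) (M.≈ᴹ-sym (M.+ᴹ-assoc _ _ _))
    ... | no  _ = coeff-++ xs ys k

    coeff-scale : ∀ c xs k → coeff (scale c xs) k ≈ᴹ c *ₗ coeff xs k
    coeff-scale c []             k = M.≈ᴹ-sym (M.*ₗ-zeroʳ c)
    coeff-scale c ((n , x) ∷ xs) k with n ℤ.≟ k
    ... | yes _ = M.≈ᴹ-trans (M.+ᴹ-congˡ (coeff-scale c xs k)) (M.≈ᴹ-sym (M.*ₗ-distribˡ c _ _))
    ... | no  _ = coeff-scale c xs k

    coeff-negate : ∀ xs k → coeff (negate xs) k +ᴹ coeff xs k ≈ᴹ 0ᴹ
    coeff-negate []             k = M.+ᴹ-identityˡ 0ᴹ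
    coeff-negate ((n , x) ∷ xs) k with n ℤ.≟ k
    ... | no  _ = coeff-negate xs k
    ... | yes _ =
      M.≈ᴹ-trans (M.+ᴹ-assoc (-ᴹ x) (coeff (negate xs) k) (x +ᴹ coeff xs k))
      (M.≈ᴹ-trans (M.+ᴹ-congˡ (M.≈ᴹ-trans
          (M.+ᴹ-congˡ (M.+ᴹ-comm x (coeff xs k)))
          (M.≈ᴹ-trans (M.≈ᴹ-sym (M.+ᴹ-assoc _ _ _))
            (M.≈ᴹ-trans (M.+ᴹ-congʳ (coeff-negate xs k)) (M.+ᴹ-identityˡ x)))))
        (M.-ᴹ‿inverseˡ x))

    coeff-negate′ : ∀ xs k → coeff (negate xs) k ≈ᴹ -ᴹ coeff xs k
    coeff-negate′ xs k =
      M.≈ᴹ-trans (M.≈ᴹ-sym (M.+ᴹ-identityʳ _))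
      (M.≈ᴹ-trans (M.+ᴹ-congˡ (M.≈ᴹ-sym (M.-ᴹ‿inverseʳ (coeff xs k))))
      (M.≈ᴹ-trans (M.≈ᴹ-sym (M.+ᴹ-assoc _ _ _))
      (M.≈ᴹ-trans (M.+ᴹ-congʳ (coeff-negate xs k)) (M.+ᴹ-identityˡ _))))

    infixr 2 _▸_
    _▸_ = M.≈ᴹ-trans

    scaled : ∀ c {x} xs k → c *ₗ coeff xs k ≈ᴹ x → coeff (scale c xs) k ≈ᴹ x
    scaled c xs k p = coeff-scale c xs k ▸ p

    ++-to : ∀ xs ys k {z} → coeff xs k +ᴹ coeff ys k ≈ᴹ z → coeff (xs ++ ys) k ≈ᴹ z
    ++-to xs ys k p = coeff-++ xs ys k ▸ p

  leftModule : LeftModule 𝐑 m ℓm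
  leftModule = record
    { Carrierᴹ = LPoly
    ; _≈ᴹ_ = _≈ᴸ_
    ; _+ᴹ_ = _++_
    ; _*ₗ_ = scale
    ; 0ᴹ   = []
    ; -ᴹ_  = negate
    ; isLeftModule = record
      { isLeftSemimodule = record
        { +ᴹ-isCommutativeMonoid = record
          { isMonoid = record
            { isSemigroup = record
              { isMagma = record
                { isEquivalence = record
                  { refl  = λ k → M.≈ᴹ-refl
                  ; sym   = λ p k → M.≈ᴹ-sym (p k)
                  ; trans = λ p q k → M.≈ᴹ-trans (p k) (q k)
                  }
                ; ∙-cong = λ {xs} {ys} {us} {vs} p q k →
                    ++-to xs us k (M.+ᴹ-cong (p k) (q k) ▸ M.≈ᴹ-sym (coeff-++ ys vs k))
                }
              ; assoc = λ xs ys zs k →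
                  ++-to (xs ++ ys) zs k
                    (M.+ᴹ-congʳ (coeff-++ xs ys k) ▸ M.+ᴹ-assoc _ _ _
                      ▸ M.+ᴹ-congˡ (M.≈ᴹ-sym (coeff-++ ys zs k))
                      ▸ M.≈ᴹ-sym (coeff-++ xs (ys ++ zs) k))
              }
            ; identity = (λ xs k → M.≈ᴹ-refl)
                       , (λ xs k → ++-to xs [] k (M.+ᴹ-identityʳ _))
            }
          ; comm = λ xs ys k →
              ++-to xs ys k (M.+ᴹ-comm _ _ ▸ M.≈ᴹ-sym (coeff-++ ys xs k))
          }
        ; isPreleftSemimodule = record
          { *ₗ-cong = λ {c} {d} {xs} {ys} c≈d p k →
              scaled c xs k (M.*ₗ-cong c≈d (p k) ▸ M.≈ᴹ-sym (coeff-scale d ys k))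
          ; *ₗ-zeroˡ = λ xs k → scaled 𝐑.0# xs k (M.*ₗ-zeroˡ _)
          ; *ₗ-distribʳ = λ xs c d k →
              scaled (c 𝐑.+ d) xs k (M.*ₗ-distribʳ _ c d ▸ M.≈ᴹ-sym
                (++-to (scale c xs) (scale d xs) k
                  (M.+ᴹ-cong (coeff-scale c xs k) (coeff-scale d xs k))))
          ; *ₗ-identityˡ = λ xs k → scaled 𝐑.1# xs k (M.*ₗ-identityˡ _)
          ; *ₗ-assoc = λ c d xs k →
              scaled (c 𝐑.* d) xs k (M.*ₗ-assoc c d _ ▸ M.≈ᴹ-sym
                (scaled c (scale d xs) k (M.*ₗ-congˡ (coeff-scale d xs k))))
          ; *ₗ-zeroʳ = λ c k → M.≈ᴹ-refl
          ; *ₗ-distribˡ = λ c xs ys k →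
              scaled c (xs ++ ys) k (M.*ₗ-congˡ (coeff-++ xs ys k) ▸ M.*ₗ-distribˡ c _ _
                ▸ M.≈ᴹ-sym (++-to (scale c xs) (scale c ys) k
                  (M.+ᴹ-cong (coeff-scale c xs k) (coeff-scale c ys k))))
          }
        }
      ; -ᴹ‿cong = λ {xs} {ys} p k →
          coeff-negate′ xs k ▸ M.-ᴹ‿cong (p k) ▸ M.≈ᴹ-sym (coeff-negate′ ys k)
      ; -ᴹ‿inverse =
          (λ xs k → ++-to (negate xs) xs k (coeff-negate xs k))
        , (λ xs k → ++-to xs (negate xs) k (M.+ᴹ-comm _ _ ▸ coeff-negate xs k))
      }
    }

module Polynomials {c ℓ} (𝐊 : CommutativeRing c ℓ) where
  private
    module 𝐊 = CommutativeRing 𝐊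
  open 𝐊 using () renaming (Carrier to K)

  infixl 6 _⊕_
  infixl 7 _⊗_
  infix  8 ⊝_
  infix  4 _≃_

  -- The free commutative K-algebra on x₀, x₁, …: algebra expressions modulo
  -- the congruence generated by the commutative ring laws and by con being a
  -- ring homomorphism.
  data Poly : Set c where
    con : K → Poly
    var : ℕ → Poly
    _⊕_ _⊗_ : Poly → Poly → Poly
    ⊝_ : Poly → Poly

  data _≃_ : Poly → Poly → Set (c ⊔ ℓ) where
    ≃-refl  : ∀ {x} → x ≃ x
    ≃-sym   : ∀ {x y} → x ≃ y → y ≃ x
    ≃-trans : ∀ {x y z} → x ≃ y → y ≃ z → x ≃ z
    ⊕-cong  : ∀ {x y u v} → x ≃ y → u ≃ v → x ⊕ u ≃ y ⊕ v
    ⊗-cong  : ∀ {x y u v} → x ≃ y → u ≃ v → x ⊗ u ≃ y ⊗ v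
    ⊝-cong  : ∀ {x y} → x ≃ y → ⊝ x ≃ ⊝ y
    ⊕-assoc     : ∀ x y z → (x ⊕ y) ⊕ z ≃ x ⊕ (y ⊕ z)
    ⊕-comm      : ∀ x y → x ⊕ y ≃ y ⊕ x
    ⊕-identityˡ : ∀ x → con 𝐊.0# ⊕ x ≃ x
    ⊝-inverseˡ  : ∀ x → ⊝ x ⊕ x ≃ con 𝐊.0#
    ⊗-assoc     : ∀ x y z → (x ⊗ y) ⊗ z ≃ x ⊗ (y ⊗ z)
    ⊗-comm      : ∀ x y → x ⊗ y ≃ y ⊗ x
    ⊗-identityˡ : ∀ x → con 𝐊.1# ⊗ x ≃ x
    distribˡ    : ∀ x y z → x ⊗ (y ⊕ z) ≃ x ⊗ y ⊕ x ⊗ z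
    con-cong : ∀ {a b} → a 𝐊.≈ b → con a ≃ con b
    con-+    : ∀ a b → con (a 𝐊.+ b) ≃ con a ⊕ con b
    con-*    : ∀ a b → con (a 𝐊.* b) ≃ con a ⊗ con b

  commutativeRing : CommutativeRing c (c ⊔ ℓ)
  commutativeRing = record
    { Carrier = Poly
    ; _≈_ = _≃_
    ; _+_ = _⊕_
    ; _*_ = _⊗_
    ; -_  = ⊝_
    ; 0#  = con 𝐊.0#
    ; 1#  = con 𝐊.1#
    ; isCommutativeRing = record
      { isRing = record
        { +-isAbelianGroup = record
          { isGroup = record
            { isMonoid = record
              { isSemigroup = record
                { isMagma = record
                  { isEquivalence = record
                    { refl = ≃-refl ; sym = ≃-sym ; trans = ≃-trans }
                  ; ∙-cong = ⊕-cong
                  }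
                ; assoc = ⊕-assoc
                }
              ; identity = ⊕-identityˡ
                         , (λ x → ≃-trans (⊕-comm _ _) (⊕-identityˡ x))
              }
            ; inverse = ⊝-inverseˡ
                      , (λ x → ≃-trans (⊕-comm _ _) (⊝-inverseˡ x))
            ; ⁻¹-cong = ⊝-cong
            }
          ; comm = ⊕-comm
          }
        ; *-cong = ⊗-cong
        ; *-assoc = ⊗-assoc
        ; *-identity = ⊗-identityˡ
                     , (λ x → ≃-trans (⊗-comm _ _) (⊗-identityˡ x))
        ; distrib = distribˡ
                  , (λ x y z → ≃-trans (⊗-comm _ _) (≃-trans (distribˡ x y z)
                      (⊕-cong (⊗-comm _ _) (⊗-comm _ _))))
        }
      ; *-comm = ⊗-comm
      }
    }

  open CommutativeRing commutativeRing using (ring)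

  restrictScalars : ∀ {m ℓm} → LeftModule ring m ℓm → LeftModule 𝐊.ring m ℓm
  restrictScalars M = record
    { Carrierᴹ = M.Carrierᴹ
    ; _≈ᴹ_ = M._≈ᴹ_
    ; _+ᴹ_ = M._+ᴹ_
    ; _*ₗ_ = λ a x → con a M.*ₗ x
    ; 0ᴹ   = M.0ᴹ
    ; -ᴹ_  = M.-ᴹ_
    ; isLeftModule = record
      { isLeftSemimodule = record
        { +ᴹ-isCommutativeMonoid = M.+ᴹ-isCommutativeMonoid
        ; isPreleftSemimodule = record
          { *ₗ-cong      = λ p q → M.*ₗ-cong (con-cong p) q
          ; *ₗ-zeroˡ     = M.*ₗ-zeroˡ
          ; *ₗ-distribʳ  = λ x a b →
              M.≈ᴹ-trans (M.*ₗ-congʳ (con-+ a b)) (M.*ₗ-distribʳ x (con a) (con b))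
          ; *ₗ-identityˡ = M.*ₗ-identityˡ
          ; *ₗ-assoc     = λ a b x →
              M.≈ᴹ-trans (M.*ₗ-congʳ (con-* a b)) (M.*ₗ-assoc (con a) (con b) x)
          ; *ₗ-zeroʳ     = λ a → M.*ₗ-zeroʳ (con a)
          ; *ₗ-distribˡ  = λ a → M.*ₗ-distribˡ (con a)
          }
        }
      ; -ᴹ‿cong    = M.-ᴹ‿cong
      ; -ᴹ‿inverse = M.-ᴹ‿inverse
      }
    }
    where module M = LeftModule M

-- All parts are positive, so that each partition occurs once.
record Partition : Set where
  field
    parts      : List ℕ
    decreasing : Linked ℕ._≥_ parts
    positive   : All (0 ℕ.<_) parts

open Partition public using (parts)

-- Positions t in a partition are counted from 0, so part λ t is λ_{t+1};
-- it is 0 beyond the length.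
part : List ℕ → ℕ → ℕ
part []       t       = 0
part (x ∷ xs) zero    = x
part (x ∷ xs) (suc t) = part xs t

-- (λ₁ + 1, …, λₜ + 1, λₜ₊₂, λₜ₊₃, …), with λ extended by zeros.
strip : ℕ → List ℕ → List ℕ
strip zero    []       = []
strip zero    (x ∷ xs) = xs
strip (suc t) []       = 1 ∷ strip t []
strip (suc t) (x ∷ xs) = suc x ∷ strip t xs

module Fock {c ℓ} (𝐊 : CommutativeRing c ℓ) where
  private
    module 𝐊 = CommutativeRing 𝐊
  open 𝐊 using () renaming (Carrier to K)
  open Polynomials 𝐊 using (con; var; restrictScalars)
    renaming (commutativeRing to 𝐁)
  open CommutativeRing 𝐁 using (_≈_; _+_; _*_; -_; 0#; 1#; ring; semiring)
    renaming (Carrier to B)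
  open SemiringExp semiring using (_^_)
  open Determinant ring using (det)

  B-moduleᴷ : LeftModule 𝐊.ring c (c ⊔ ℓ)
  B-moduleᴷ = restrictScalars (TensorUnit.leftModule {R = ring})

  -- 𝓑 = B[z, z⁻¹]
  module 𝓑ᴮ = Laurent (TensorUnit.leftModule {R = ring})

  𝓑-moduleᴮ : LeftModule ring c (c ⊔ ℓ)
  𝓑-moduleᴮ = 𝓑ᴮ.leftModule

  𝓑-moduleᴷ : LeftModule 𝐊.ring c (c ⊔ ℓ)
  𝓑-moduleᴷ = restrictScalars 𝓑-moduleᴮ

  open LeftModule 𝓑-moduleᴮ public using ()
    renaming (Carrierᴹ to 𝓑; _≈ᴹ_ to _≈𝓑_; _*ₗ_ to _*𝓑_)

  infix 9 _z^_

  _z^_ : B → ℤ → 𝓑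
  b z^ m = (m , b) ∷ []

  -- Laurent polynomials in u over K and over 𝓑; the latter can be multiplied
  -- by Laurent polynomials over K (_⊛_) and by formal series over B (_⊙_).
  module K[u] = Laurent (TensorUnit.leftModule {R = 𝐊.ring})
  module 𝓑[u] = Laurent 𝓑-moduleᴷ
  open 𝓑[u] public using (_⊛_)
  open Laurent 𝓑-moduleᴮ public using (_⊙_)

  pow : K[u].LPoly → ℕ → K[u].LPoly
  pow g zero    = K[u].constant 𝐊.1#
  pow g (suc p) = g K[u].⊛ pow g p

  -- Formal series in u and u⁻¹; F k is the coefficient of uᵏ.
  u^_·_ : ∀ {a} {A : Set a} → ℤ → (ℤ → A) → (ℤ → A)
  (u^ d · F) k = F (k ℤ.- d)

  z^_·_ : ℤ → (ℤ → 𝓑) → (ℤ → 𝓑)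
  (z^ d · F) k = 𝓑ᴮ.shift d (F k)

  infixr 6 u^_·_ z^_·_

  -- F(-u⁻¹)
  at-neg-inv : (ℤ → B) → (ℤ → B)
  at-neg-inv F k = (- 1#) ^ ℤ.∣ k ∣ * F (ℤ.- k)

  -- The grading has deg (var n) = n + 1.
  monomial : List ℕ → B
  monomial = List.foldr (λ n x → var n * x) 1#

  degree : List ℕ → ℕ
  degree ns = sum (List.map suc ns)

  infix 4 _∈B≤_

  _∈B≤_ : B → ℤ → Set (c ⊔ ℓ)
  x ∈B≤ d = ∃ λ cs → All (λ (_ , ns) → + degree ns ℤ.≤ d) cs
                   × Sums.combination B-moduleᴷ monomial cs ≈ x

  h⁰ : ℤ → B
  h⁰ (+ zero)   = 1#
  h⁰ (+ suc n)  = var n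
  h⁰ (-[1+ _ ]) = 0#

  δ : ℤ → ℤ → B
  δ m n with m ℤ.≟ n
  ... | yes _ = 1#
  ... | no  _ = 0#

  IsLinearᴮ : (B → B) → Set (c ⊔ ℓ)
  IsLinearᴮ = LeftModuleMorphisms.IsLeftModuleHomomorphism
    (LeftModule.rawLeftModule B-moduleᴷ) (LeftModule.rawLeftModule B-moduleᴷ)

  IsLinear𝓑 : (𝓑 → 𝓑) → Set (c ⊔ ℓ)
  IsLinear𝓑 = LeftModuleMorphisms.IsLeftModuleHomomorphism
    (LeftModule.rawLeftModule 𝓑-moduleᴷ) (LeftModule.rawLeftModule 𝓑-moduleᴷ)

  -- Throughout, h r k is h^{(r)}_k.
  record IsFamily (h : ℤ → ℤ → B) : Set (c ⊔ ℓ) where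
    field
      extends     : ∀ k → h (+ 0) k ≈ h⁰ k
      bounded     : ∀ r k → h r k ∈B≤ k ℤ.+ r
      diagonal    : ∀ k → h k (ℤ.- k) ≈ 1#
      below       : ∀ r k → k ℤ.+ r ℤ.< + 0 → h r k ≈ 0#

  module _ (h : ℤ → ℤ → B) where

    -- The determinants of size N ≥ length λ all agree for h as above; this is
    -- the one of size length λ.  Indices i, j : Fin n are 0-based.
    s : List ℤ → B
    s λs = det {length λs} λ i j → h (+ toℕ j) (lookup λs i ℤ.- + toℕ i)

    sᴾ : Partition → B
    sᴾ λs = s (List.map +_ (parts λs))

    -- e p a is e^{(p)}_a; for p = a the determinant is empty, hence 1.
    e : ℤ → ℤ → B
    e p a with p ℤ.- a
    ... | -[1+ _ ] = 0#
    ... | + n      = det {n} λ i j → h (ℤ.- p ℤ.+ + suc (toℕ j)) (p ℤ.- + toℕ i)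

    HasSchurBasis : Set (c ⊔ ℓ)
    HasSchurBasis = Sums.IsBasis B-moduleᴷ sᴾ

    record IsPsi (ψ : ℤ → 𝓑 → 𝓑) : Set (c ⊔ ℓ) where
      field
        linear : ∀ k → IsLinear𝓑 (ψ k)
        value  : ∀ k λs m → ψ k (sᴾ λs z^ m)
          ≈𝓑 s (k ℤ.- m ℤ.- 1ℤ ∷ List.map +_ (parts λs)) z^ (m ℤ.+ 1ℤ)

    -- The term t here is the term t + 1 of the sum over 1, 2, ….
    record IsPsi* (ψ* : ℤ → 𝓑 → 𝓑) : Set (c ⊔ ℓ) where
      field
        linear : ∀ k → IsLinear𝓑 (ψ* k)
        value  : ∀ k λs m → Sums.IsSum 𝓑-moduleᴷ
          (λ t → ((- 1#) ^ t * δ (k ℤ.- m ℤ.- 1ℤ) (+ part (parts λs) t ℤ.- + suc t))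
                 *𝓑 (s (List.map +_ (strip t (parts λs))) z^ (m ℤ.- 1ℤ)))
          (ψ* k (sᴾ λs z^ m))

    -- D p is D_p.
    record IsLowerD (D : ℤ → B → B) : Set (c ⊔ ℓ) where
      field
        linear  : ∀ p → IsLinearᴮ (D p)
        inside  : ∀ λs (p : Fin (suc (length (parts λs)))) →
          D (+ toℕ p) (sᴾ λs) ≈ det {length (parts λs)} λ i j →
            h (+ toℕ (punchIn p j)) (+ lookup (parts λs) i ℤ.- + suc (toℕ i))
        outside : ∀ λs p → ¬ (+ 0 ℤ.≤ p × p ℤ.≤ + length (parts λs)) →
          D p (sᴾ λs) ≈ 0#

    -- D p is D^{(p)}.
    record IsUpperD (D : ℤ → B → B) : Set (c ⊔ ℓ) where
      field
        linear : ∀ p → IsLinearᴮ (D p)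
        value  : ∀ p λs → Sums.IsSum B-moduleᴷ
          (λ t → (- 1#) ^ t * h p (+ part (parts λs) t ℤ.- + suc t ℤ.+ + 2)
                 * s (List.map +_ (strip t (parts λs))))
          (D p (sᴾ λs))

  -- The extension of an operator on B to 𝓑 commuting with z.
  extend : (B → B) → 𝓑 → 𝓑
  extend D = List.map (map₂ D)

  -- y = DE(g(u)) x = Σ_{p ≥ 0} g(u)ᵖ D_p x
  IsDE : (ℤ → B → B) → K[u].LPoly → 𝓑 → 𝓑[u].LPoly → Set (c ⊔ ℓ)
  IsDE D g x y = Sums.IsSum 𝓑[u].leftModule
    (λ p → pow g p ⊛ 𝓑[u].constant (extend (D (+ p)) x)) y

  -- y = DH(g(u)⁻¹) x = Σ_{p > 0} g(u)ᵖ D^{(-p)} x, with p = q + 1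
  IsDH⁻¹ : (ℤ → B → B) → K[u].LPoly → 𝓑 → 𝓑[u].LPoly → Set (c ⊔ ℓ)
  IsDH⁻¹ D g x y = Sums.IsSum 𝓑[u].leftModule
    (λ q → pow g (suc q) ⊛ 𝓑[u].constant (extend (D -[1+ q ]) x)) y

  -- f(u) = u⁻¹ + a₀ + a₁ u + … + a_l uˡ; here l+1 is a variable name, and
  -- the value 0 (that is, f(u) = u⁻¹) is allowed.
  f : ∀ {l+1} → (Fin l+1 → K) → K[u].LPoly
  f a = (-[1+ 0 ] , 𝐊.1#) ∷ List.tabulate (λ i → + toℕ i , a i)

  Recurrence : K[u].LPoly → (ℤ → ℤ → B) → Set (c ⊔ ℓ)
  Recurrence g h = ∀ p k →
    h p k ≈ List.foldr (λ (i , b) x → con b * h (p ℤ.- 1ℤ) (k ℤ.- i) + x) 0# g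

  -- The generating functions on 𝓑^{(m)}, applied to the element zᵐ b.
  Ψ : (ℤ → 𝓑 → 𝓑) → ℤ → B → (ℤ → 𝓑)
  Ψ ψ m b k = ψ k (b z^ m)

  Ψ* : (ℤ → 𝓑 → 𝓑) → ℤ → B → (ℤ → 𝓑)
  Ψ* ψ* m b k = ψ* (ℤ.- k) (b z^ m)

  infix 4 _≈ˢ_

  _≈ˢ_ : (ℤ → 𝓑) → (ℤ → 𝓑) → Set (c ⊔ ℓ)
  F ≈ˢ G = ∀ k → F k ≈𝓑 G k

{-# OPTIONS --safe #-}
module Submission where

open import Defs
open import Algebra.Bundles using (CommutativeMonoid; Ring; CommutativeRing)
open import Algebra.Module.Bundles using (LeftModule)
import Algebra.Module.Construct.TensorUnit as TensorUnit
open import Algebra.Module.Morphism.Structures using (module LeftModuleMorphisms)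
import Algebra.Properties.CommutativeMonoid.Sum as CommutativeMonoidSum
import Algebra.Properties.CommutativeSemigroup as CommutativeSemigroupProperties
import Algebra.Properties.Ring as RingProperties
import Algebra.Properties.Semiring.Exp as SemiringExp
import Algebra.Properties.Semiring.Sum as SemiringSum
import Algebra.Solver.Ring.NaturalCoefficients.Default as NaturalSolver
open import Data.Fin.Base using (Fin; zero; suc; toℕ; fromℕ; fromℕ<; inject₁; pinch; punchIn)
open import Data.Fin.Properties using (toℕ-inject₁; toℕ-fromℕ; toℕ-fromℕ<; toℕ<n)
open import Data.Integer.Base as ℤ using (ℤ; +_; -[1+_]; 0ℤ; 1ℤ; ∣_∣)
import Data.Integer.Properties as ℤ
open import Data.Integer.Tactic.RingSolver using (solve-∀)
open import Data.List.Base as List using (List; []; _∷_; _++_; length; lookup)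
open import Data.List.Properties using (length-map)
open import Data.List.Relation.Unary.All as All using (All; []; _∷_)
open import Data.List.Relation.Unary.All.Properties using (tabulate⁺)
open import Data.Nat.Base as ℕ using (ℕ; zero; suc)
open import Data.Nat.ListAction using () renaming (sum to total)
import Data.Nat.Properties as ℕ
open import Data.Product.Base using (∃; _×_; _,_; proj₁; proj₂)
open import Data.Unit.Base using (tt)
open import Function.Base using (_∘_; id)
open import Level using (_⊔_)
import Relation.Binary.Reasoning.Setoid as SetoidReasoning
open import Relation.Binary.PropositionalEquality as ≡ using (_≡_)
open import Relation.Nullary using (yes; no; contradiction)

-- By the recurrence, the coefficient of uᵏ in f(u)ᵖ H(u) is h p k for p ≥ 0, so
-- the first formula is the expansion of s (k - m - 1 ∷ λ) along its first row.
--
-- For the second formula, let E p k be the entry in column - k and row p of the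
-- inverse of the lower unitriangular matrix (h (- p) M), M, p ∈ ℤ.  Expanding
-- its minors shows E p k = (- 1)^(p + k) e p (- k), and the recurrence for h
-- turns into E (p + 1) k = Σᵢ aᵢ E p (k - i), so E p k is the coefficient of uᵏ
-- in f(u)ᵖ E(- u⁻¹) for p ≥ 0.  Summing E p k D⁽⁻ᵖ⁾ s_λ over all p ∈ ℤ gives the
-- formula for ψ*; the terms with p ≤ 0 vanish, because D⁽ʳ⁾ s_λ for r ≥ 0 is a
-- determinant with a repeated column.

-- Sums over all p ∈ ℤ make sense because of two one-sided vanishing rules: `h (- p) M` is zero for
-- p > M, and `E p k` is zero for p < - k. Every matrix product is therefore a finite sum, and being
-- inverse means only an orthogonality relation over any range of p that contains - k ≤ p ≤ M.
-- Unitriangularity gives uniqueness: two sequences that agree far enough to the left and have the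
-- same product with every row agree everywhere. This transfers the recurrence from the entries `h`
-- to the determinants `E`, where it is not visible directly.
--
-- The Kronecker delta in ψ* is itself an entry of the product of the two matrices; writing it so is
-- what brings in the operators D⁽⁻ᵖ⁾.
--
-- The operators are known only through their values on the Schur basis, and the place where a
-- series over p breaks off depends on the partition. Both formulas are therefore proved on s_λ for
-- every sufficiently large cutoff, and one cutoff is then chosen for the finitely many partitions
-- in an expansion of b.

-- Finite sums over initial segments of ℕ

module RangeSums {c ℓ} (M : CommutativeMonoid c ℓ) where
  open CommutativeMonoid M
    renaming (_∙_ to _+_; ε to 0#; ∙-cong to +-cong; ∙-congˡ to +-congˡ;
              identityˡ to +-identityˡ; identityʳ to +-identityʳ; assoc to +-assoc)
  open CommutativeMonoidSum M using (sum; sum-cong-≋; sum-replicate-zero)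

  -- Summands are functions on ℕ, so that one summand can be summed over ranges of different
  -- lengths; the form is the one in `IsSum`.
  ∑ : ℕ → (ℕ → Carrier) → Carrier
  ∑ N g = sum {N} (g ∘ toℕ)

  ∑-cong< : ∀ N {g g′} → (∀ t → t ℕ.< N → g t ≈ g′ t) → ∑ N g ≈ ∑ N g′
  ∑-cong< zero    p = refl
  ∑-cong< (suc N) p = +-cong (p 0 (ℕ.s≤s ℕ.z≤n)) (∑-cong< N λ t t<N → p (suc t) (ℕ.s≤s t<N))

  ∑-cong : ∀ N {g g′} → (∀ t → g t ≈ g′ t) → ∑ N g ≈ ∑ N g′
  ∑-cong N p = ∑-cong< N λ t _ → p t

  ∑-zero : ∀ N {g} → (∀ t → t ℕ.< N → g t ≈ 0#) → ∑ N g ≈ 0#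
  ∑-zero N p = trans (∑-cong< N p) (sum-replicate-zero N)

  ∑-split : ∀ N N′ g → ∑ (N ℕ.+ N′) g ≈ ∑ N g + ∑ N′ (g ∘ (N ℕ.+_))
  ∑-split zero    N′ g = sym (+-identityˡ _)
  ∑-split (suc N) N′ g = trans (+-congˡ (∑-split N N′ (g ∘ suc))) (sym (+-assoc _ _ _))

  ∑-snoc : ∀ N g → ∑ (suc N) g ≈ ∑ N g + g N
  ∑-snoc zero    g = trans (+-identityʳ _) (sym (+-identityˡ _))
  ∑-snoc (suc N) g = trans (+-congˡ (∑-snoc N (g ∘ suc))) (sym (+-assoc _ _ _))

  ∑-extend : ∀ {N N′} g → N ℕ.≤ N′ → (∀ t → N ℕ.≤ t → g t ≈ 0#) → ∑ N′ g ≈ ∑ N g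
  ∑-extend {N} {N′} g N≤N′ p = trans
    (reflexive (≡.cong (λ n → ∑ n g) (≡.sym (ℕ.m+[n∸m]≡n N≤N′))))
    (trans (∑-split N (N′ ℕ.∸ N) g)
    (trans (+-congˡ (∑-zero (N′ ℕ.∸ N) λ t _ → p (N ℕ.+ t) (ℕ.m≤m+n N t)))
    (+-identityʳ _)))

  -- The cutoff in `IsSum` is arbitrary; two of them are compared through `N + N′`.
  ∑-unique : ∀ {N N′} g → (∀ t → N ℕ.≤ t → g t ≈ 0#) → (∀ t → N′ ℕ.≤ t → g t ≈ 0#) →
             ∑ N g ≈ ∑ N′ g
  ∑-unique {N} {N′} g p p′ = trans
    (sym (∑-extend g (ℕ.m≤m+n N N′) p)) (∑-extend g (ℕ.m≤n+m N′ N) p′)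

-- Deleting two positions in either order

punchIn-pinch : ∀ {n} (p : Fin (suc n)) (k : Fin n) → punchIn (punchIn p k) (pinch k p) ≡ p
punchIn-pinch zero    zero    = ≡.refl
punchIn-pinch zero    (suc k) = ≡.refl
punchIn-pinch (suc p) zero    = ≡.refl
punchIn-pinch (suc p) (suc k) = ≡.cong suc (punchIn-pinch p k)

-- The deleted positions are `p` and `punchIn p k`; when the latter goes first, `p` is found at
-- `pinch k p`.
punchIn-swap : ∀ {n} (p : Fin (suc (suc n))) (k : Fin (suc n)) (i : Fin n) →
  punchIn (punchIn p k) (punchIn (pinch k p) i) ≡ punchIn p (punchIn k i)
punchIn-swap zero    zero    i       = ≡.refl
punchIn-swap zero    (suc k) i       = ≡.refl
punchIn-swap (suc p) zero    i       = ≡.refl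
punchIn-swap (suc p) (suc k) zero    = ≡.refl
punchIn-swap {suc n} (suc p) (suc k) (suc i) = ≡.cong suc (punchIn-swap p k i)

punchIn-inject₁ : ∀ {n} (j : Fin (suc n)) (k : Fin n) →
  punchIn (inject₁ j) (inject₁ k) ≡ inject₁ (punchIn j k)
punchIn-inject₁ zero    k       = ≡.refl
punchIn-inject₁ (suc j) zero    = ≡.refl
punchIn-inject₁ (suc j) (suc k) = ≡.cong suc (punchIn-inject₁ j k)

punchIn-inject₁-fromℕ : ∀ {n} (j : Fin (suc n)) → punchIn (inject₁ j) (fromℕ n) ≡ fromℕ (suc n)
punchIn-inject₁-fromℕ {n}     zero    = ≡.refl
punchIn-inject₁-fromℕ {suc n} (suc j) = ≡.cong suc (punchIn-inject₁-fromℕ j)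

punchIn-fromℕ : ∀ {n} (k : Fin n) → punchIn (fromℕ n) k ≡ inject₁ k
punchIn-fromℕ zero    = ≡.refl
punchIn-fromℕ (suc k) = ≡.cong suc (punchIn-fromℕ k)

-- Determinants: column expansion, repeated columns, Hessenberg minors

module DeterminantProperties {c ℓ} (𝐑 : CommutativeRing c ℓ) where
  open CommutativeRing 𝐑 hiding (zero)
  open Determinant ring public using (det)
  open SemiringExp semiring using (_^_)
  open SemiringSum semiring
  open RingProperties ring using (-1*x≈-x; -‿involutive)
  open SetoidReasoning setoid
  open NaturalSolver commutativeSemiring using (solve; _:=_; _:*_; con)

  private
    sgn : ∀ {n} → Fin n → Carrier
    sgn i = (- 1#) ^ toℕ i

  det-cong : ∀ {n} {A B : Fin n → Fin n → Carrier} → (∀ i j → A i j ≈ B i j) → det A ≈ det B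
  det-cong {zero}  p = refl
  det-cong {suc n} p = sum-cong-≋ λ j →
    *-cong (*-congˡ {sgn j} (p zero j)) (det-cong λ i k → p (suc i) (punchIn j k))

  private
    -1*-1 : - 1# * - 1# ≈ 1#
    -1*-1 = trans (-1*x≈-x (- 1#)) (-‿involutive 1#)

    -- Exchanging the order of two deletions changes the sum of the two positions by exactly one, up
    -- or down.
    sgn-swap : ∀ {n} (p : Fin (suc (suc n))) (k : Fin (suc n)) →
      sgn (punchIn p k) * sgn (pinch k p) ≈ - 1# * (sgn p * sgn k)
    sgn-swap zero zero =
      solve 1 (λ c → (c :* con 1) :* con 1 := c :* (con 1 :* con 1)) refl (- 1#)
    sgn-swap zero (suc k) =
      solve 2 (λ c x → (c :* (c :* x)) :* con 1 := c :* (con 1 :* (c :* x))) refl (- 1#) (sgn k)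
    sgn-swap (suc p) zero = begin
      1# * sgn p                        ≈⟨ *-congʳ -1*-1 ⟨
      (- 1# * - 1#) * sgn p
        ≈⟨ solve 2 (λ c x → (c :* c) :* x := c :* ((c :* x) :* con 1)) refl (- 1#) (sgn p) ⟩
      - 1# * ((- 1# * sgn p) * 1#)      ∎
    sgn-swap {suc n} (suc p) (suc k) = begin
      (- 1# * sgn (punchIn p k)) * (- 1# * sgn (pinch k p))
        ≈⟨ solve 3 (λ c x y → (c :* x) :* (c :* y) := (c :* c) :* (x :* y)) refl
             (- 1#) (sgn (punchIn p k)) (sgn (pinch k p)) ⟩
      (- 1# * - 1#) * (sgn (punchIn p k) * sgn (pinch k p))
        ≈⟨ *-congˡ (sgn-swap p k) ⟩
      (- 1# * - 1#) * (- 1# * (sgn p * sgn k))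
        ≈⟨ solve 3 (λ c x y → (c :* c) :* (c :* (x :* y)) := c :* ((c :* x) :* (c :* y))) refl
             (- 1#) (sgn p) (sgn k) ⟩
      - 1# * ((- 1# * sgn p) * (- 1# * sgn k)) ∎

    exchange : ∀ {m n} (x : Fin m → Carrier) (y : Fin m → Fin n → Carrier) →
      sum (λ i → x i * sum (y i)) ≈ sum (λ j → sum (λ i → x i * y i j))
    exchange x y =
      trans (sum-cong-≋ λ i → *-distribˡ-sum (x i) (y i)) (∑-comm λ i j → x i * y i j)

  -- `det` is defined by the first row, so this goes by induction on the size: column `p` is split
  -- off that expansion, and in every other minor it survives at `pinch k p` and is expanded there.
  -- Regrouping by rows costs the sign of `sgn-swap`.
  expand-column : ∀ {n} (p : Fin (suc n)) (A : Fin (suc n) → Fin (suc n) → Carrier) →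
    det A ≈ sum λ t → sgn t * sgn p * A t p * det (λ i k → A (punchIn t i) (punchIn p k))
  expand-column {zero}  zero A = +-congʳ (*-congʳ (*-congʳ (sym (*-identityˡ 1#))))
  expand-column {suc n} p    A = begin
    det A
      ≈⟨ sum-remove {i = p} (λ j → sgn j * A zero j * det (λ i k → A (suc i) (punchIn j k))) ⟩
    sgn p * A zero p * det (λ i k → A (suc i) (punchIn p k))
      + sum (λ k → sgn (punchIn p k) * a k * det (λ i l → A (suc i) (punchIn (punchIn p k) l)))
      ≈⟨ +-cong (*-congʳ (*-congʳ (sym (*-identityˡ (sgn p))))) rest ⟩
    1# * sgn p * A zero p * det (λ i k → A (suc i) (punchIn p k))
      + sum (λ t → - 1# * sgn t * sgn p * b t * sum (λ k → sgn k * a k * M t k)) ∎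
    where
    a = λ k → A zero (punchIn p k)
    b = λ t → A (suc t) p
    M = λ t k → det (λ i l → A (suc (punchIn t i)) (punchIn p (punchIn k l)))
    minor : ∀ k → det (λ i l → A (suc i) (punchIn (punchIn p k) l)) ≈
                  sum (λ t → sgn t * sgn (pinch k p) * b t * M t k)
    minor k = trans (expand-column (pinch k p) (λ i l → A (suc i) (punchIn (punchIn p k) l)))
      (sum-cong-≋ λ t → *-cong
        (*-congˡ {sgn t * sgn (pinch k p)} (reflexive (≡.cong (A (suc t)) (punchIn-pinch p k))))
        (det-cong λ i l → reflexive (≡.cong (A (suc (punchIn t i))) (punchIn-swap p k l))))
    rest : sum (λ k → sgn (punchIn p k) * a k * det (λ i l → A (suc i) (punchIn (punchIn p k) l)))
         ≈ sum (λ t → - 1# * sgn t * sgn p * b t * sum (λ k → sgn k * a k * M t k))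
    rest = begin
      sum (λ k → sgn (punchIn p k) * a k * det (λ i l → A (suc i) (punchIn (punchIn p k) l)))
        ≈⟨ sum-cong-≋ (λ k → *-congˡ {sgn (punchIn p k) * a k} (minor k)) ⟩
      sum (λ k → sgn (punchIn p k) * a k * sum (λ t → sgn t * sgn (pinch k p) * b t * M t k))
        ≈⟨ exchange (λ k → sgn (punchIn p k) * a k) (λ k t → sgn t * sgn (pinch k p) * b t * M t k) ⟩
      sum (λ t → sum (λ k → sgn (punchIn p k) * a k * (sgn t * sgn (pinch k p) * b t * M t k)))
        ≈⟨ sum-cong-≋ (λ t → sum-cong-≋ λ k → begin
             sgn (punchIn p k) * a k * (sgn t * sgn (pinch k p) * b t * M t k)
               ≈⟨ solve 6 (λ j u x q v m → j :* u :* (x :* q :* v :* m) :=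
                    (j :* q) :* (u :* x :* v :* m)) refl
                    (sgn (punchIn p k)) (a k) (sgn t) (sgn (pinch k p)) (b t) (M t k) ⟩
             sgn (punchIn p k) * sgn (pinch k p) * (a k * sgn t * b t * M t k)
               ≈⟨ *-congʳ (sgn-swap p k) ⟩
             - 1# * (sgn p * sgn k) * (a k * sgn t * b t * M t k)
               ≈⟨ solve 7 (λ c y z u x v m → c :* (y :* z) :* (u :* x :* v :* m) :=
                    c :* x :* y :* v :* (z :* u :* m)) refl
                    (- 1#) (sgn p) (sgn k) (a k) (sgn t) (b t) (M t k) ⟩
             - 1# * sgn t * sgn p * b t * (sgn k * a k * M t k) ∎) ⟩
      sum (λ t → sum (λ k → - 1# * sgn t * sgn p * b t * (sgn k * a k * M t k)))
        ≈⟨ sum-cong-≋ (λ t → *-distribˡ-sum (- 1# * sgn t * sgn p * b t) (λ k → sgn k * a k * M t k)) ⟨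
      sum (λ t → - 1# * sgn t * sgn p * b t * sum (λ k → sgn k * a k * M t k)) ∎

  -- The expansion along the first column of the square matrix obtained from C
  -- by repeating its column p in front.
  repeated-column : ∀ {n} (p : Fin n) (C : Fin (suc n) → Fin n → Carrier) →
    sum (λ t → sgn t * C t p * det (λ i k → C (punchIn t i) k)) ≈ 0#
  repeated-column {suc n} p C = begin
    1# * C zero p * det C′
      + sum (λ t → - 1# * sgn t * b t * sum (λ j → sgn j * a j * M t j))
      ≈⟨ +-cong (*-congʳ (*-identityˡ _)) (exchange (λ t → - 1# * sgn t * b t) (λ t j → sgn j * a j * M t j)) ⟩
    a p * det C′ + sum (λ j → sum (λ t → - 1# * sgn t * b t * (sgn j * a j * M t j)))
      ≈⟨ +-congˡ (sum-cong-≋ column) ⟩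
    a p * det C′ + sum (λ j → - 1# * a j * (sgn j * X j))
      -- The summand `j = p` is the expansion of `det C′` along column `p` and cancels the term of
      -- row `zero`. In every other summand column `p` is still repeated, so it vanishes by
      -- induction.
      ≈⟨ +-congˡ (sum-remove {i = p} (λ j → - 1# * a j * (sgn j * X j))) ⟩
    a p * det C′ + (- 1# * a p * (sgn p * X p)
      + sum (λ k → - 1# * a (punchIn p k) * (sgn (punchIn p k) * X (punchIn p k))))
      ≈⟨ +-congˡ (+-cong (*-congˡ Xp) (trans
           (sum-cong-≋ λ k → trans (*-congˡ (trans (*-congˡ (others p C k)) (zeroʳ _))) (zeroʳ _))
           (sum-replicate-zero n))) ⟩
    a p * det C′ + (- 1# * a p * det C′ + 0#)
      ≈⟨ +-congˡ (trans (+-identityʳ _) (*-assoc _ _ _)) ⟩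
    a p * det C′ + - 1# * (a p * det C′)
      ≈⟨ +-congˡ (-1*x≈-x _) ⟩
    a p * det C′ + - (a p * det C′)
      ≈⟨ -‿inverseʳ _ ⟩
    0# ∎
    where
    C′ = λ i k → C (suc i) k
    a = C zero
    b = λ t → C (suc t) p
    M = λ t j → det (λ i k → C (suc (punchIn t i)) (punchIn j k))
    X = λ j → sum (λ t → sgn t * b t * M t j)
    column : ∀ j → sum (λ t → - 1# * sgn t * b t * (sgn j * a j * M t j)) ≈ - 1# * a j * (sgn j * X j)
    column j = begin
      sum (λ t → - 1# * sgn t * b t * (sgn j * a j * M t j))
        ≈⟨ sum-cong-≋ (λ t → solve 6 (λ c x v z u m → c :* x :* v :* (z :* u :* m) :=
             (c :* u :* z) :* (x :* v :* m)) refl (- 1#) (sgn t) (b t) (sgn j) (a j) (M t j)) ⟩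
      sum (λ t → - 1# * a j * sgn j * (sgn t * b t * M t j))
        ≈⟨ *-distribˡ-sum (- 1# * a j * sgn j) (λ t → sgn t * b t * M t j) ⟨
      - 1# * a j * sgn j * X j
        ≈⟨ *-assoc _ _ _ ⟩
      - 1# * a j * (sgn j * X j) ∎
    Xp : sgn p * X p ≈ det C′
    Xp = begin
      sgn p * X p
        ≈⟨ *-distribˡ-sum (sgn p) (λ t → sgn t * b t * M t p) ⟩
      sum (λ t → sgn p * (sgn t * b t * M t p))
        ≈⟨ sum-cong-≋ (λ t → solve 4 (λ y x v m → y :* (x :* v :* m) := x :* y :* v :* m) refl
             (sgn p) (sgn t) (b t) (M t p)) ⟩
      sum (λ t → sgn t * sgn p * b t * M t p)
        ≈⟨ expand-column p C′ ⟨
      det C′ ∎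
    others : ∀ {n} (p : Fin (suc n)) (C : Fin (suc (suc n)) → Fin (suc n) → Carrier) (k : Fin n) →
      sum (λ t → sgn t * C (suc t) p * det (λ i l → C (suc (punchIn t i)) (punchIn (punchIn p k) l))) ≈ 0#
    others {suc n} p C k = trans
      (sum-cong-≋ λ t →
        *-congʳ {det (λ i l → C (suc (punchIn t i)) (punchIn (punchIn p k) l))}
          (*-congˡ {sgn t} (reflexive (≡.cong (C (suc t)) (≡.sym (punchIn-pinch p k))))))
      (repeated-column (pinch k p) (λ t l → C (suc t) (punchIn (punchIn p k) l)))

  private
    sum-zero : ∀ {n} {g : Fin n → Carrier} → (∀ i → g i ≈ 0#) → sum g ≈ 0#
    sum-zero {n} p = trans (sum-cong-≋ p) (sum-replicate-zero n)

    term-zero : ∀ {x y} z → y ≈ 0# → x * y * z ≈ 0#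
    term-zero {x} z p = trans (*-congʳ (trans (*-congˡ p) (zeroʳ x))) (zeroˡ z)

  unit-first-column : ∀ {n} (A : Fin (suc n) → Fin (suc n) → Carrier) →
    A zero zero ≈ 1# → (∀ i → A (suc i) zero ≈ 0#) → det A ≈ det (λ i j → A (suc i) (suc j))
  unit-first-column {n} A p q = trans (expand-column zero A)
    (trans (+-cong
      (trans (*-congʳ (trans (*-cong (*-identityˡ 1#) p) (*-identityˡ 1#))) (*-identityˡ _))
      (sum-zero λ t →
        term-zero {sgn (suc t) * sgn {suc n} zero} (det (λ i k → A (punchIn (suc t) i) (suc k))) (q t)))
    (+-identityʳ _))

  zero-last-row : ∀ {n} (A : Fin (suc n) → Fin (suc n) → Carrier) →
    (∀ j → A (fromℕ n) j ≈ 0#) → det A ≈ 0#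
  zero-last-row {zero}  A p = trans (+-identityʳ _)
    (trans (*-congʳ (trans (*-congˡ (p zero)) (zeroʳ _))) (zeroˡ _))
  zero-last-row {suc n} A p = sum-zero λ j → trans
    (*-congˡ {sgn j * A zero j} (zero-last-row (λ i k → A (suc i) (punchIn j k)) (λ k → p (punchIn j k))))
    (zeroʳ _)

  -- The last row survives at the bottom of every minor of the first-row expansion. The minor
  -- without the last column has a zero row; all the others have the same shape again.
  unit-last-row : ∀ {n} (A : Fin (suc n) → Fin (suc n) → Carrier) →
    (∀ j → A (fromℕ n) (inject₁ j) ≈ 0#) → A (fromℕ n) (fromℕ n) ≈ 1# →
    det A ≈ det (λ i j → A (inject₁ i) (inject₁ j))
  unit-last-row {zero}  A p q = trans (+-identityʳ _)
    (trans (*-identityʳ _) (trans (*-identityˡ _) q))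
  unit-last-row {suc n} A p q = begin
    det A
      ≈⟨ sum-init-last (λ j → sgn j * A zero j * det (λ i k → A (suc i) (punchIn j k))) ⟩
    sum (λ j → sgn (inject₁ j) * A zero (inject₁ j) * det (λ i k → A (suc i) (punchIn (inject₁ j) k)))
      + sgn (fromℕ (suc n)) * A zero (fromℕ (suc n)) * det (λ i k → A (suc i) (punchIn (fromℕ (suc n)) k))
      ≈⟨ +-cong (sum-cong-≋ λ j → *-cong
             (*-congʳ {A zero (inject₁ j)} (reflexive (≡.cong ((- 1#) ^_) (toℕ-inject₁ j)))) (minor j))
           (trans
             (*-congˡ (zero-last-row (λ i k → A (suc i) (punchIn (fromℕ (suc n)) k))
               λ k → trans (reflexive (≡.cong (A (fromℕ (suc n))) (punchIn-fromℕ k))) (p k)))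
             (zeroʳ _)) ⟩
    det (λ i j → A (inject₁ i) (inject₁ j)) + 0#
      ≈⟨ +-identityʳ _ ⟩
    det (λ i j → A (inject₁ i) (inject₁ j)) ∎
    where
    minor : ∀ j → det (λ i k → A (suc i) (punchIn (inject₁ j) k)) ≈
                  det (λ i k → A (suc (inject₁ i)) (inject₁ (punchIn j k)))
    minor j = trans
      (unit-last-row (λ i k → A (suc i) (punchIn (inject₁ j) k))
        (λ k → trans (reflexive (≡.cong (A (fromℕ (suc n))) (punchIn-inject₁ j k))) (p (punchIn j k)))
        (trans (reflexive (≡.cong (A (fromℕ (suc n))) (punchIn-inject₁-fromℕ j))) q))
      (det-cong λ i k → reflexive (≡.cong (A (suc (inject₁ i))) (punchIn-inject₁ j k)))

  -- Deleting the first row moves the subdiagonal of ones onto the diagonal. The columns to the left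
  -- of `j` then form a unitriangular block with zeros below it, which splits off one column at a
  -- time.
  minor-hessenberg : ∀ {n} (j : Fin (suc n)) (A : ℕ → ℕ → Carrier) →
    (∀ i → A (suc i) i ≈ 1#) → (∀ {i k} → k ℕ.< i → A (suc i) k ≈ 0#) →
    det {n} (λ i k → A (suc (toℕ i)) (toℕ (punchIn j k))) ≈
    det {n ℕ.∸ toℕ j} (λ i k → A (suc (toℕ j ℕ.+ toℕ i)) (suc (toℕ j ℕ.+ toℕ k)))
  minor-hessenberg         zero    A p q = refl
  minor-hessenberg {suc n} (suc j) A p q = trans
    (unit-first-column (λ i k → A (suc (toℕ i)) (toℕ (punchIn (suc j) k))) (p 0) (λ i → q (ℕ.s≤s ℕ.z≤n)))
    (minor-hessenberg j (λ i k → A (suc i) (suc k)) (λ i → p (suc i)) (λ k<i → q (ℕ.s≤s k<i)))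

-- Integer inequalities behind the vanishing conditions and cutoffs

i≤+∣i∣ : ∀ i → i ℤ.≤ + ∣ i ∣
i≤+∣i∣ (+ n)    = ℤ.≤-refl
i≤+∣i∣ -[1+ n ] = ℤ.-≤+

<0-resp : ∀ {i j} → i ≡ j → i ℤ.< 0ℤ → j ℤ.< 0ℤ
<0-resp = ≡.subst (ℤ._< 0ℤ)

i<1+∣i∣ : ∀ i → i ℤ.- + suc ∣ i ∣ ℤ.< 0ℤ
i<1+∣i∣ i = ℤ.≤-<-trans (ℤ.+-monoˡ-≤ (ℤ.- + suc ∣ i ∣) (i≤+∣i∣ i))
  (<0-resp (eq (+ ∣ i ∣)) ℤ.-<+)
  where
  eq : ∀ a → ℤ.- 1ℤ ≡ a ℤ.- (1ℤ ℤ.+ a)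
  eq = solve-∀

i-j<0⇒i<j : ∀ {i j} → i ℤ.- j ℤ.< 0ℤ → i ℤ.< j
i-j<0⇒i<j {i} {j} i-j<0 = ≡.subst₂ ℤ._<_ (eq i j) (ℤ.+-identityˡ j) (ℤ.+-monoˡ-< j i-j<0)
  where
  eq : ∀ i j → i ℤ.- j ℤ.+ j ≡ i
  eq = solve-∀

i-n≤i : ∀ i n → i ℤ.- + n ℤ.≤ i
i-n≤i i n = ≡.subst (i ℤ.- + n ℤ.≤_) (ℤ.+-identityʳ i) (ℤ.+-monoʳ-≤ i ℤ.neg-≤-pos)

<0-- : ∀ {i} n → i ℤ.< 0ℤ → i ℤ.- + n ℤ.< 0ℤ
<0-- {i} n = ℤ.≤-<-trans (i-n≤i i n)

-- Orthogonality of h and e, and the recurrence for e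

module FamilyProperties {c ℓ} (𝐊 : CommutativeRing c ℓ) where
  open Fock 𝐊
  open Polynomials 𝐊 using (con) renaming (commutativeRing to 𝐁)
  open CommutativeRing 𝐁 hiding (zero) renaming (Carrier to B)
  open SemiringExp semiring using (_^_)
  open SemiringSum semiring using (∑-distrib-+; *-distribˡ-sum; *-distribʳ-sum; sum-cong-≋)
  open RingProperties ring using (-1*x≈-x; -‿involutive; -‿distribˡ-*; +-cancelʳ)
  open CommutativeSemigroupProperties *-commutativeSemigroup using (x∙yz≈y∙xz)
  open RangeSums +-commutativeMonoid
  open DeterminantProperties 𝐁
  open SetoidReasoning setoid

  δ-cong : ∀ {i j i′ j′} → i ℤ.- j ≡ i′ ℤ.- j′ → δ i j ≈ δ i′ j′
  δ-cong {i} {j} {i′} {j′} eq with i ℤ.≟ j | i′ ℤ.≟ j′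
  ... | yes _ | yes _ = refl
  ... | no  _ | no  _ = refl
  ... | yes p | no ¬q = contradiction
    (ℤ.i-j≡0⇒i≡j i′ j′ (≡.trans (≡.sym eq) (ℤ.i≡j⇒i-j≡0 p))) ¬q
  ... | no ¬p | yes q = contradiction
    (ℤ.i-j≡0⇒i≡j i j (≡.trans eq (ℤ.i≡j⇒i-j≡0 q))) ¬p

  -- The sum of F p over hi - N < p ≤ hi.
  ∑↓ : ℤ → ℕ → (ℤ → B) → B
  ∑↓ hi N F = ∑ N (λ t → F (hi ℤ.- + t))

  -- The coefficient of uᵏ in g(u) Σ F k uᵏ.
  act : K[u].LPoly → (ℤ → B) → ℤ → B
  act g F k = List.foldr (λ (i , b) x → con b * F (k ℤ.- i) + x) 0# g

  act-cong : ∀ {P : ℤ → Set} {g} F F′ k k′ → All (λ (i , _) → P i) g →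
    (∀ {i} → P i → F (k ℤ.- i) ≈ F′ (k′ ℤ.- i)) → act g F k ≈ act g F′ k′
  act-cong F F′ k k′ []         F≈F′ = refl
  act-cong F F′ k k′ (Pi ∷ Pg) F≈F′ = +-cong (*-congˡ (F≈F′ Pi)) (act-cong F F′ k k′ Pg F≈F′)

  act-zero : ∀ {P : ℤ → Set} {g} F k → All (λ (i , _) → P i) g →
    (∀ {i} → P i → F (k ℤ.- i) ≈ 0#) → act g F k ≈ 0#
  act-zero F k []         F≈0 = refl
  act-zero F k (Pi ∷ Pg) F≈0 =
    trans (+-cong (trans (*-congˡ (F≈0 Pi)) (zeroʳ _)) (act-zero F k Pg F≈0)) (+-identityˡ 0#)

  ∑-*ˡ : ∀ N x y → x * ∑ N y ≈ ∑ N (λ t → x * y t)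
  ∑-*ˡ N x y = *-distribˡ-sum {N} x (y ∘ toℕ)

  ∑-*ʳ : ∀ N x y → ∑ N y * x ≈ ∑ N (λ t → y t * x)
  ∑-*ʳ N x y = *-distribʳ-sum {N} x (y ∘ toℕ)

  ∑-+ : ∀ N x y → ∑ N (λ t → x t + y t) ≈ ∑ N x + ∑ N y
  ∑-+ N x y = ∑-distrib-+ {N} (x ∘ toℕ) (y ∘ toℕ)

  ∑-act : ∀ N (x : ℕ → B) g (F : ℕ → ℤ → B) k →
    ∑ N (λ t → x t * act g (F t) k) ≈ act g (λ k → ∑ N (λ t → x t * F t k)) k
  ∑-act N x []            F k = ∑-zero N λ t _ → zeroʳ (x t)
  ∑-act N x ((i , b) ∷ g) F k = begin
    ∑ N (λ t → x t * (con b * F t (k ℤ.- i) + act g (F t) k))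
      ≈⟨ ∑-cong N (λ t → trans (distribˡ (x t) (con b * F t (k ℤ.- i)) (act g (F t) k))
           (+-congʳ (x∙yz≈y∙xz (x t) (con b) (F t (k ℤ.- i))))) ⟩
    ∑ N (λ t → con b * (x t * F t (k ℤ.- i)) + x t * act g (F t) k)
      ≈⟨ ∑-+ N (λ t → con b * (x t * F t (k ℤ.- i))) (λ t → x t * act g (F t) k) ⟩
    ∑ N (λ t → con b * (x t * F t (k ℤ.- i))) + ∑ N (λ t → x t * act g (F t) k)
      ≈⟨ +-cong (sym (∑-*ˡ N (con b) (λ t → x t * F t (k ℤ.- i)))) (∑-act N x g F k) ⟩
    con b * ∑ N (λ t → x t * F t (k ℤ.- i)) + act g (λ k → ∑ N (λ t → x t * F t k)) k ∎

  module _ {h : ℤ → ℤ → B} (isFamily : IsFamily h) where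
    open IsFamily isFamily

    diagonal′ : ∀ {r k} → k ℤ.+ r ≡ 0ℤ → h r k ≈ 1#
    diagonal′ {r} {k} eq = trans (reflexive (≡.cong (h r) k≡-r)) (diagonal r)
      where
      lemma : ∀ k r → k ≡ (k ℤ.+ r) ℤ.- r
      lemma = solve-∀
      k≡-r : k ≡ ℤ.- r
      k≡-r = ≡.trans (lemma k r) (≡.trans (≡.cong (ℤ._- r) eq) (ℤ.+-identityˡ (ℤ.- r)))

    -- The matrix of `e h p a` depends on `a` only through its size, so it is a truncation of this
    -- infinite one. The indices of an entry add up to `suc j - i`: ones on the subdiagonal, zeros
    -- below.
    hessenberg : ℤ → ℕ → ℕ → B
    hessenberg p i j = h (ℤ.- p ℤ.+ + suc j) (p ℤ.- + i)

    hessDet : ℤ → ℕ → B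
    hessDet p n = det {n} λ i j → hessenberg p (toℕ i) (toℕ j)

    e-hess : ∀ p a n → p ℤ.- a ≡ + n → e h p a ≡ hessDet p n
    e-hess p a n eq with p ℤ.- a | eq
    ... | .(+ n) | ≡.refl = ≡.refl

    e-below : ∀ p a → p ℤ.- a ℤ.< 0ℤ → e h p a ≡ 0#
    e-below p a p-a<0 with p ℤ.- a | p-a<0
    ... | -[1+ _ ] | _        = ≡.refl
    ... | + _      | ℤ.+<+ ()

    -- In the first-row expansion, `minor-hessenberg` cuts each minor down to its lower right block,
    -- which belongs to the same family with `p` lowered by `suc j`.
    hess-suc : ∀ p n → hessDet p (suc n) ≈
      ∑ (suc n) λ j → (- 1#) ^ j * h (ℤ.- p ℤ.+ + suc j) p * hessDet (p ℤ.- + suc j) (n ℕ.∸ j)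
    hess-suc p n = sum-cong-≋ {suc n} λ j → *-cong
      (*-congˡ {(- 1#) ^ toℕ j} (reflexive (≡.cong (h (ℤ.- p ℤ.+ + suc (toℕ j))) (ℤ.+-identityʳ p))))
      (trans (minor-hessenberg {n} j (hessenberg p) (λ i → diagonal′ (diag p (+ suc i)))
        (λ {i} {k} k<i → below _ _ (<0-resp (sub p (+ k) (+ i))
          (≡.subst (+ k ℤ.- + i ℤ.<_) (ℤ.+-inverseʳ (+ i)) (ℤ.+-monoˡ-< (ℤ.- + i) (ℤ.+<+ k<i))))))
      (det-cong {n ℕ.∸ toℕ j} λ i k → reflexive
        (≡.cong₂ h (row p (+ toℕ j) (+ toℕ k)) (column p (+ toℕ j) (+ toℕ i)))))
      where
      diag : ∀ p i → p ℤ.- i ℤ.+ (ℤ.- p ℤ.+ i) ≡ 0ℤ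
      diag = solve-∀
      sub : ∀ p k i → k ℤ.- i ≡ p ℤ.- (1ℤ ℤ.+ i) ℤ.+ (ℤ.- p ℤ.+ (1ℤ ℤ.+ k))
      sub = solve-∀
      row : ∀ p j k → ℤ.- p ℤ.+ (1ℤ ℤ.+ (1ℤ ℤ.+ (j ℤ.+ k))) ≡ ℤ.- (p ℤ.- (1ℤ ℤ.+ j)) ℤ.+ (1ℤ ℤ.+ k)
      row = solve-∀
      column : ∀ p j i → p ℤ.- (1ℤ ℤ.+ (j ℤ.+ i)) ≡ p ℤ.- (1ℤ ℤ.+ j) ℤ.- i
      column = solve-∀

    -- The coefficient of uᵏ in f(u)ᵖ E(-u⁻¹).
    E : ℤ → ℤ → B
    E p k = (- 1#) ^ ∣ p ℤ.+ k ∣ * e h p (ℤ.- k)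

    p--k : ∀ p k → p ℤ.- (ℤ.- k) ≡ p ℤ.+ k
    p--k = solve-∀

    E-hess : ∀ p k n → p ℤ.+ k ≡ + n → E p k ≈ (- 1#) ^ n * hessDet p n
    E-hess p k n eq = reflexive (≡.cong₂ (λ i x → (- 1#) ^ ∣ i ∣ * x) eq
      (e-hess p (ℤ.- k) n (≡.trans (p--k p k) eq)))

    E-below : ∀ p k → p ℤ.+ k ℤ.< 0ℤ → E p k ≈ 0#
    E-below p k p+k<0 = trans
      (*-congˡ (reflexive (e-below p (ℤ.- k) (<0-resp (≡.sym (p--k p k)) p+k<0)))) (zeroʳ _)

    -- Summed over `p`, this is the entry of the matrix product in row `M` and column `- k`. It can
    -- be nonzero only for - k ≤ p ≤ M.
    hE : ℤ → ℤ → ℤ → B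
    hE M k p = h (ℤ.- p) M * E p k

    hE-below : ∀ M k p → p ℤ.+ k ℤ.< 0ℤ → hE M k p ≈ 0#
    hE-below M k p p+k<0 = trans (*-congˡ (E-below p k p+k<0)) (zeroʳ _)

    hE-above : ∀ M k p → M ℤ.- p ℤ.< 0ℤ → hE M k p ≈ 0#
    hE-above M k p M<p = trans (*-congʳ (below (ℤ.- p) M M<p)) (zeroˡ _)

    sign-∸ : ∀ n j → j ℕ.≤ n → (- 1#) ^ suc n * (- 1#) ^ j ≈ - ((- 1#) ^ (n ℕ.∸ j))
    sign-∸ n zero j≤n = trans (*-identityʳ _) (-1*x≈-x _)
    sign-∸ (suc n) (suc j) (ℕ.s≤s j≤n) = begin
      - 1# * (- 1#) ^ suc n * (- 1# * (- 1#) ^ j)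
        ≈⟨ *-cong (-1*x≈-x _) (-1*x≈-x _) ⟩
      - ((- 1#) ^ suc n) * - ((- 1#) ^ j)
        ≈⟨ trans (sym (-‿distribˡ-* _ _)) (-‿cong (trans (*-comm _ _) (sym (-‿distribˡ-* _ _)))) ⟩
      - (- ((- 1#) ^ j * (- 1#) ^ suc n))
        ≈⟨ trans (-‿involutive _) (*-comm _ _) ⟩
      (- 1#) ^ suc n * (- 1#) ^ j
        ≈⟨ sign-∸ n j j≤n ⟩
      - ((- 1#) ^ (n ℕ.∸ j)) ∎

    -- The range is exactly - k ≤ p ≤ M. For positive `n` the term p = M is `E M k`, and the
    -- first-row expansion of its determinant is the negative of the sum of the remaining terms.
    orthogonal-exact : ∀ M k n → M ℤ.+ k ≡ + n → ∑↓ M (suc n) (hE M k) ≈ δ 0ℤ (+ n)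
    orthogonal-exact M k zero eq = begin
      hE M k (M ℤ.- 0ℤ) + 0#
        ≈⟨ +-identityʳ _ ⟩
      h (ℤ.- (M ℤ.- 0ℤ)) M * E (M ℤ.- 0ℤ) k
        ≈⟨ *-cong (diagonal′ (M-M M)) (E-hess (M ℤ.- 0ℤ) k 0 (≡.trans (≡.cong (ℤ._+ k) (ℤ.+-identityʳ M)) eq)) ⟩
      1# * (1# * 1#)
        ≈⟨ trans (*-identityˡ _) (*-identityˡ _) ⟩
      1# ∎
      where
      M-M : ∀ M → M ℤ.+ ℤ.- (M ℤ.- 0ℤ) ≡ 0ℤ
      M-M = solve-∀
    orthogonal-exact M k (suc n) eq = begin
      hE M k (M ℤ.- 0ℤ) + ∑ (suc n) (λ j → hE M k (M ℤ.- + suc j))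
        ≈⟨ +-cong (reflexive (≡.cong (hE M k) (ℤ.+-identityʳ M))) (∑-cong< (suc n) rest) ⟩
      hE M k M + ∑ (suc n) (λ j → - 1# * ((- 1#) ^ suc n * T j))
        ≈⟨ +-cong head (trans (sym (∑-*ˡ (suc n) (- 1#) (λ j → (- 1#) ^ suc n * T j)))
             (trans (-1*x≈-x _) (-‿cong (sym (∑-*ˡ (suc n) _ T))))) ⟩
      (- 1#) ^ suc n * ∑ (suc n) T + - ((- 1#) ^ suc n * ∑ (suc n) T)
        ≈⟨ -‿inverseʳ _ ⟩
      0# ∎
      where
      T : ℕ → B
      T j = (- 1#) ^ j * h (ℤ.- M ℤ.+ + suc j) M * hessDet (M ℤ.- + suc j) (n ℕ.∸ j)
      head : hE M k M ≈ (- 1#) ^ suc n * ∑ (suc n) T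
      head = trans (*-cong (diagonal′ (ℤ.+-inverseʳ M)) (E-hess M k (suc n) eq))
        (trans (*-identityˡ _) (*-congˡ (hess-suc M n)))
      index : ∀ M j → ℤ.- (M ℤ.- j) ≡ ℤ.- M ℤ.+ j
      index = solve-∀
      swap : ∀ M k j → M ℤ.- j ℤ.+ k ≡ M ℤ.+ k ℤ.- j
      swap = solve-∀
      rest : ∀ j → j ℕ.< suc n → hE M k (M ℤ.- + suc j) ≈ - 1# * ((- 1#) ^ suc n * T j)
      rest j (ℕ.s≤s j≤n) = begin
        h (ℤ.- (M ℤ.- + suc j)) M * E (M ℤ.- + suc j) k
          ≈⟨ *-cong (reflexive (≡.cong (λ r → h r M) (index M (+ suc j))))
               (E-hess (M ℤ.- + suc j) k (n ℕ.∸ j) (≡.trans (swap M k (+ suc j))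
                 (≡.trans (≡.cong (ℤ._- + suc j) eq)
                   (≡.trans (ℤ.m-n≡m⊖n (suc n) (suc j)) (≡.trans (ℤ.[1+m]⊖[1+n]≡m⊖n n j) (ℤ.⊖-≥ j≤n)))))) ⟩
        x * ((- 1#) ^ (n ℕ.∸ j) * y)
          ≈⟨ *-congˡ (*-congʳ (trans (sym (-‿involutive _))
               (trans (-‿cong (sym (sign-∸ n j j≤n))) (sym (-1*x≈-x _))))) ⟩
        x * (- 1# * ((- 1#) ^ suc n * (- 1#) ^ j) * y)
          ≈⟨ solve 5 (λ x c a b y → x :* (c :* (a :* b) :* y) := c :* (a :* (b :* x :* y))) refl
               x (- 1#) ((- 1#) ^ suc n) ((- 1#) ^ j) y ⟩
        - 1# * ((- 1#) ^ suc n * T j) ∎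
        where
        open NaturalSolver commutativeSemiring using (solve; _:=_; _:*_)
        x = h (ℤ.- M ℤ.+ + suc j) M
        y = hessDet (M ℤ.- + suc j) (n ℕ.∸ j)

    hE-beyond : ∀ hi N M k → hi ℤ.- + N ℤ.+ k ℤ.< 0ℤ → ∀ t → N ℕ.≤ t → hE M k (hi ℤ.- + t) ≈ 0#
    hE-beyond hi N M k lo<0 t N≤t = hE-below M k (hi ℤ.- + t) (<0-resp
      (≡.trans (eq hi (+ N) k (+ (t ℕ.∸ N))) (≡.cong (λ t → hi ℤ.- + t ℤ.+ k) (ℕ.m+[n∸m]≡n N≤t)))
      (<0-- (t ℕ.∸ N) lo<0))
      where
      eq : ∀ hi N k d → hi ℤ.- N ℤ.+ k ℤ.- d ≡ hi ℤ.- (N ℤ.+ d) ℤ.+ k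
      eq = solve-∀

    -- Any range that reaches up to `M` and down to `- k` gives the same sum. If `M + k` is
    -- negative, the two vanishing rules together cover every p.
    orthogonal : ∀ hi N M k → M ℤ.≤ hi → hi ℤ.- + N ℤ.+ k ℤ.< 0ℤ →
      ∑↓ hi N (hE M k) ≈ δ 0ℤ (M ℤ.+ k)
    orthogonal hi N M k M≤hi lo<0 with M ℤ.+ k in eq
    ... | + n = begin
      ∑↓ hi N (hE M k)
        ≈⟨ ∑-unique (λ t → hE M k (hi ℤ.- + t)) (hE-beyond hi N M k lo<0)
             (hE-beyond hi (a ℕ.+ suc n) M k below-n) ⟩
      ∑↓ hi (a ℕ.+ suc n) (hE M k)
        ≈⟨ ∑-split a (suc n) (λ t → hE M k (hi ℤ.- + t)) ⟩
      ∑↓ hi a (hE M k) + ∑ (suc n) (λ t → hE M k (hi ℤ.- + (a ℕ.+ t)))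
        ≈⟨ +-cong (∑-zero a above-M) (∑-cong (suc n) λ t → reflexive (≡.cong (hE M k)
             (≡.trans (≡.cong (ℤ._- + (a ℕ.+ t)) hi≡M+a) (drop M (+ a) (+ t))))) ⟩
      0# + ∑↓ M (suc n) (hE M k)
        ≈⟨ +-identityˡ _ ⟩
      ∑↓ M (suc n) (hE M k)
        ≈⟨ orthogonal-exact M k n eq ⟩
      δ 0ℤ (+ n) ∎
      where
      a = ∣ hi ℤ.- M ∣
      difference : ∀ hi M → hi ≡ M ℤ.+ (hi ℤ.- M)
      difference = solve-∀
      hi≡M+a : hi ≡ M ℤ.+ + a
      hi≡M+a = ≡.trans (difference hi M) (≡.cong (λ i → M ℤ.+ i)
        (≡.sym (ℤ.0≤i⇒+∣i∣≡i (ℤ.i≤j⇒0≤j-i M≤hi))))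
      drop : ∀ M a t → M ℤ.+ a ℤ.- (a ℤ.+ t) ≡ M ℤ.- t
      drop = solve-∀
      below-n : hi ℤ.- + (a ℕ.+ suc n) ℤ.+ k ℤ.< 0ℤ
      below-n = <0-resp (≡.trans (lemma M k (+ a) (+ n) eq)
        (≡.cong (λ hi → hi ℤ.- + (a ℕ.+ suc n) ℤ.+ k) (≡.sym hi≡M+a))) ℤ.-<+
        where
        lemma₀ : ∀ M k a n → M ℤ.+ k ℤ.- n ℤ.- 1ℤ ≡ M ℤ.+ a ℤ.- (a ℤ.+ (1ℤ ℤ.+ n)) ℤ.+ k
        lemma₀ = solve-∀
        lemma : ∀ M k a n → M ℤ.+ k ≡ n → -[1+ 0 ] ≡ M ℤ.+ a ℤ.- (a ℤ.+ (1ℤ ℤ.+ n)) ℤ.+ k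
        lemma M k a n eq = ≡.trans
          (≡.sym (≡.trans (≡.cong (λ i → i ℤ.- n ℤ.- 1ℤ) eq) (≡.cong (ℤ._- 1ℤ) (ℤ.+-inverseʳ n))))
          (lemma₀ M k a n)
      above-M : ∀ t → t ℕ.< a → hE M k (hi ℤ.- + t) ≈ 0#
      above-M t t<a = hE-above M k (hi ℤ.- + t) (<0-resp
        (≡.trans (lemma M (+ a) (+ t)) (≡.cong (λ hi → M ℤ.- (hi ℤ.- + t)) (≡.sym hi≡M+a)))
        (≡.subst (+ t ℤ.- + a ℤ.<_) (ℤ.+-inverseʳ (+ a)) (ℤ.+-monoˡ-< (ℤ.- + a) (ℤ.+<+ t<a))))
        where
        lemma : ∀ M a t → t ℤ.- a ≡ M ℤ.- (M ℤ.+ a ℤ.- t)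
        lemma = solve-∀
    ... | -[1+ n ] = ∑-zero N λ t _ → vanish (hi ℤ.- + t)
      where
      lemma : ∀ M k p → M ℤ.+ k ℤ.- (p ℤ.+ k) ≡ M ℤ.- p
      lemma = solve-∀
      vanish : ∀ p → hE M k p ≈ 0#
      vanish p with p ℤ.+ k ℤ.<? 0ℤ
      ... | yes p+k<0 = hE-below M k p p+k<0
      ... | no  p+k≮0 = hE-above M k p (<0-resp (≡.trans (≡.cong (ℤ._- (p ℤ.+ k)) (≡.sym eq)) (lemma M k p))
        (ℤ.+-mono-<-≤ {x = -[1+ n ]} ℤ.-<+ (ℤ.neg-mono-≤ (ℤ.≮⇒≥ p+k≮0))))

    -- The infinite matrix with entry h (- p) M in row M and column p is lower
    -- unitriangular.
    unitriangular-injective : ∀ lo {X Y : ℤ → B} → (∀ p → p ℤ.< lo → X p ≈ Y p) →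
      (∀ M → ∃ λ N → ∑↓ M (suc N) (λ p → h (ℤ.- p) M * X p) ≈ ∑↓ M (suc N) (λ p → h (ℤ.- p) M * Y p)) →
      ∀ p → X p ≈ Y p
    unitriangular-injective lo {X} {Y} base X≈Y p = below-suc (suc ∣ p ℤ.- lo ∣) p
      (i-j<0⇒i<j (<0-resp (rearrange p lo (+ ∣ p ℤ.- lo ∣)) (i<1+∣i∣ (p ℤ.- lo))))
      where
      rearrange : ∀ p lo n → p ℤ.- lo ℤ.- (1ℤ ℤ.+ n) ≡ p ℤ.- (lo ℤ.+ (1ℤ ℤ.+ n))
      rearrange = solve-∀
      below-suc : ∀ n p → p ℤ.< lo ℤ.+ + n → X p ≈ Y p
      below-suc zero    p p<lo = base p (≡.subst (p ℤ.<_) (ℤ.+-identityʳ lo) p<lo)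
      -- Row `p` has coefficient one at index `p` and otherwise involves only smaller indices, where
      -- `X` and `Y` agree by induction; the common remainder is cancelled.
      below-suc (suc n) p p<lo = +-cancelʳ _ _ _ (begin
        X p + ∑ N (λ t → h (ℤ.- (p ℤ.- + suc t)) p * X (p ℤ.- + suc t))
          ≈⟨ +-congʳ (head X) ⟨
        ∑↓ p (suc N) (λ q → h (ℤ.- q) p * X q)
          ≈⟨ proj₂ (X≈Y p) ⟩
        ∑↓ p (suc N) (λ q → h (ℤ.- q) p * Y q)
          ≈⟨ +-cong (head Y) (∑-cong N λ t →
               *-congˡ {h (ℤ.- (p ℤ.- + suc t)) p} (sym (below-suc n (p ℤ.- + suc t) (smaller t)))) ⟩
        Y p + ∑ N (λ t → h (ℤ.- (p ℤ.- + suc t)) p * X (p ℤ.- + suc t)) ∎)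
        where
        N = proj₁ (X≈Y p)
        p-0 : ∀ p → p ℤ.+ ℤ.- (p ℤ.- 0ℤ) ≡ 0ℤ
        p-0 = solve-∀
        head : ∀ Z → h (ℤ.- (p ℤ.- 0ℤ)) p * Z (p ℤ.- 0ℤ) ≈ Z p
        head Z = trans (*-cong (diagonal′ (p-0 p)) (reflexive (≡.cong Z (ℤ.+-identityʳ p)))) (*-identityˡ _)
        shift₁ : ∀ p t → p ℤ.- 1ℤ ℤ.- t ≡ p ℤ.- (1ℤ ℤ.+ t)
        shift₁ = solve-∀
        shift₂ : ∀ lo n → lo ℤ.+ (1ℤ ℤ.+ n) ℤ.- 1ℤ ≡ lo ℤ.+ n
        shift₂ = solve-∀
        smaller : ∀ t → p ℤ.- + suc t ℤ.< lo ℤ.+ + n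
        smaller t = ≡.subst₂ ℤ._<_ (shift₁ p (+ t)) (shift₂ lo (+ n))
          (ℤ.≤-<-trans (i-n≤i (p ℤ.- 1ℤ) t) (ℤ.+-monoˡ-< (ℤ.- 1ℤ) p<lo))

    -- As functions of `p` both sides vanish for p + 1 + k < 0; for the right one this uses i ≥ -1.
    -- It remains to compare their products with row `M` of the unitriangular matrix. The recurrence
    -- rewrites `h (- p) M` through the entries `h (- (p + 1)) (M - i)`, so the left product becomes
    -- the combination of the deltas at `M - i + k`, and the right one that of the deltas at
    -- `M + (k - i)`.
    E-recurrence : ∀ g → All (λ (i , _) → -[1+ 0 ] ℤ.≤ i) g → Recurrence g h →
      ∀ p k → E (p ℤ.+ 1ℤ) k ≈ act g (E p) k
    E-recurrence g g≥-1 recurrence p k = unitriangular-injective (ℤ.- (k ℤ.+ 1ℤ)) low (λ M → N M , equal M) p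
      where
      lower : ∀ x i → -[1+ 0 ] ℤ.≤ i → x ℤ.+ 1ℤ ℤ.+ k ℤ.< 0ℤ → x ℤ.+ (k ℤ.- i) ℤ.< 0ℤ
      lower x i i≥-1 x<0 = <0-resp (eq x i k) (ℤ.+-mono-<-≤ x<0 (ℤ.i≤j⇒i-j≤0 i≥-1))
        where
        eq : ∀ x i k → x ℤ.+ 1ℤ ℤ.+ k ℤ.+ (ℤ.- 1ℤ ℤ.- i) ≡ x ℤ.+ (k ℤ.- i)
        eq = solve-∀
      low : ∀ p → p ℤ.< ℤ.- (k ℤ.+ 1ℤ) → E (p ℤ.+ 1ℤ) k ≈ act g (E p) k
      low p p<lo = trans (E-below (p ℤ.+ 1ℤ) k p+1+k<0)
        (sym (act-zero (E p) k g≥-1 λ {i} i≥-1 → E-below p (k ℤ.- i) (lower p i i≥-1 p+1+k<0)))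
        where
        eq : ∀ p k → p ℤ.+ (k ℤ.+ 1ℤ) ≡ p ℤ.+ 1ℤ ℤ.+ k
        eq = solve-∀
        p+1+k<0 : p ℤ.+ 1ℤ ℤ.+ k ℤ.< 0ℤ
        p+1+k<0 = <0-resp (eq p k)
          (≡.subst (p ℤ.+ (k ℤ.+ 1ℤ) ℤ.<_) (ℤ.+-inverseˡ (k ℤ.+ 1ℤ)) (ℤ.+-monoˡ-< (k ℤ.+ 1ℤ) p<lo))
      -- With `suc (N M)` terms even the range starting at `M + 1` reaches down to `- k`, so one
      -- length serves both uses of `orthogonal`.
      N : ℤ → ℕ
      N M = ∣ M ℤ.+ 1ℤ ℤ.+ k ∣
      equal : ∀ M → ∑↓ M (suc (N M)) (λ p → h (ℤ.- p) M * E (p ℤ.+ 1ℤ) k) ≈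
                    ∑↓ M (suc (N M)) (λ p → h (ℤ.- p) M * act g (E p) k)
      equal M = begin
        ∑ n (λ t → h (ℤ.- (M ℤ.- + t)) M * E (M ℤ.- + t ℤ.+ 1ℤ) k)
          ≈⟨ ∑-cong n (λ t → trans (*-comm _ _) (*-cong
               (reflexive (≡.cong (λ p → E p k) (shift M (+ t))))
               (trans (recurrence (ℤ.- (M ℤ.- + t)) M)
                 (reflexive (≡.cong (λ p → act g (h p) M) (pred M (+ t))))))) ⟩
        ∑ n (λ t → E (M ℤ.+ 1ℤ ℤ.- + t) k * act g (h (ℤ.- (M ℤ.+ 1ℤ ℤ.- + t))) M)
          ≈⟨ ∑-act n (λ t → E (M ℤ.+ 1ℤ ℤ.- + t) k) g (λ t → h (ℤ.- (M ℤ.+ 1ℤ ℤ.- + t))) M ⟩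
        act g (λ M′ → ∑ n (λ t → E (M ℤ.+ 1ℤ ℤ.- + t) k * h (ℤ.- (M ℤ.+ 1ℤ ℤ.- + t)) M′)) M
          ≈⟨ act-cong
               (λ M′ → ∑ n (λ t → E (M ℤ.+ 1ℤ ℤ.- + t) k * h (ℤ.- (M ℤ.+ 1ℤ ℤ.- + t)) M′))
               (λ k′ → ∑ n (λ t → h (ℤ.- (M ℤ.- + t)) M * E (M ℤ.- + t) k′))
               M k g≥-1 (λ {i} i≥-1 → begin
               ∑ n (λ t → E (M ℤ.+ 1ℤ ℤ.- + t) k * h (ℤ.- (M ℤ.+ 1ℤ ℤ.- + t)) (M ℤ.- i))
                 ≈⟨ ∑-cong n (λ t → *-comm (E (M ℤ.+ 1ℤ ℤ.- + t) k) (h (ℤ.- (M ℤ.+ 1ℤ ℤ.- + t)) (M ℤ.- i))) ⟩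
               ∑↓ (M ℤ.+ 1ℤ) n (hE (M ℤ.- i) k)
                 ≈⟨ orthogonal (M ℤ.+ 1ℤ) n (M ℤ.- i) k
                      (ℤ.+-monoʳ-≤ M (ℤ.neg-mono-≤ i≥-1)) top<0 ⟩
               δ 0ℤ (M ℤ.- i ℤ.+ k)
                 ≈⟨ δ-cong (≡.cong (λ i → 0ℤ ℤ.- i) (move M i k)) ⟩
               δ 0ℤ (M ℤ.+ (k ℤ.- i))
                 ≈⟨ orthogonal M n M (k ℤ.- i) ℤ.≤-refl
                      (lower (M ℤ.- + n) i i≥-1 (<0-resp (swap M (+ n) k) top<0)) ⟨
               ∑↓ M n (hE M (k ℤ.- i)) ∎) ⟩
        act g (λ k′ → ∑ n (λ t → h (ℤ.- (M ℤ.- + t)) M * E (M ℤ.- + t) k′)) k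
          ≈⟨ ∑-act n (λ t → h (ℤ.- (M ℤ.- + t)) M) g (λ t → E (M ℤ.- + t)) k ⟨
        ∑ n (λ t → h (ℤ.- (M ℤ.- + t)) M * act g (E (M ℤ.- + t)) k) ∎
        where
        n = suc (N M)
        shift : ∀ M t → M ℤ.- t ℤ.+ 1ℤ ≡ M ℤ.+ 1ℤ ℤ.- t
        shift = solve-∀
        pred : ∀ M t → ℤ.- (M ℤ.- t) ℤ.- 1ℤ ≡ ℤ.- (M ℤ.+ 1ℤ ℤ.- t)
        pred = solve-∀
        move : ∀ M i k → M ℤ.- i ℤ.+ k ≡ M ℤ.+ (k ℤ.- i)
        move = solve-∀
        swap : ∀ M n k → M ℤ.+ 1ℤ ℤ.- n ℤ.+ k ≡ M ℤ.- n ℤ.+ 1ℤ ℤ.+ k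
        swap = solve-∀
        top : ∀ M n k → M ℤ.+ 1ℤ ℤ.+ k ℤ.- n ≡ M ℤ.+ 1ℤ ℤ.- n ℤ.+ k
        top = solve-∀
        top<0 : M ℤ.+ 1ℤ ℤ.- + n ℤ.+ k ℤ.< 0ℤ
        top<0 = <0-resp (top M (+ n) k) (i<1+∣i∣ (M ℤ.+ 1ℤ ℤ.+ k))

-- Parts of vectors and partitions, extended by zeros

-- The counterpart of `part` for integer vectors: the part that ψ puts in front may be negative.
entry : List ℤ → ℕ → ℤ
entry []       t       = 0ℤ
entry (x ∷ xs) zero    = x
entry (x ∷ xs) (suc t) = entry xs t

entry-lookup : ∀ xs (i : Fin (length xs)) → entry xs (toℕ i) ≡ lookup xs i
entry-lookup (x ∷ xs) zero    = ≡.refl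
entry-lookup (x ∷ xs) (suc i) = entry-lookup xs i

entry-beyond : ∀ xs {t} → length xs ℕ.≤ t → entry xs t ≡ 0ℤ
entry-beyond []       _          = ≡.refl
entry-beyond (x ∷ xs) (ℕ.s≤s ≤t) = entry-beyond xs ≤t

entry-part : ∀ xs t → entry (List.map +_ xs) t ≡ + part xs t
entry-part []       t       = ≡.refl
entry-part (x ∷ xs) zero    = ≡.refl
entry-part (x ∷ xs) (suc t) = entry-part xs t

part-lookup : ∀ xs (i : Fin (length xs)) → part xs (toℕ i) ≡ lookup xs i
part-lookup (x ∷ xs) zero    = ≡.refl
part-lookup (x ∷ xs) (suc i) = part-lookup xs i

part-beyond : ∀ xs {t} → length xs ℕ.≤ t → part xs t ≡ 0
part-beyond []       _          = ≡.refl
part-beyond (x ∷ xs) (ℕ.s≤s ≤t) = part-beyond xs ≤t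

part≤total : ∀ xs t → part xs t ℕ.≤ total xs
part≤total []       t       = ℕ.z≤n
part≤total (x ∷ xs) zero    = ℕ.m≤m+n x (total xs)
part≤total (x ∷ xs) (suc t) = ℕ.≤-trans (part≤total xs t) (ℕ.m≤n+m (total xs) x)

length-strip : ∀ {t N} xs → t ℕ.≤ N → length xs ℕ.≤ N → length (strip t xs) ℕ.≤ N
length-strip {zero}  []       _          _          = ℕ.z≤n
length-strip {zero}  (x ∷ xs) _          xs<N       = ℕ.<⇒≤ xs<N
length-strip {suc t} []       (ℕ.s≤s t≤N) _          = ℕ.s≤s (length-strip [] t≤N ℕ.z≤n)
length-strip {suc t} (x ∷ xs) (ℕ.s≤s t≤N) (ℕ.s≤s ≤N) = ℕ.s≤s (length-strip xs t≤N ≤N)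

-- Row t of the matrix h⁽ʲ⁾ at content λ t; deleting this row leaves the matrix
-- of s (strip t λ), by content-strip.
content : List ℕ → ℕ → ℤ
content xs t = + part xs t ℤ.- + suc t ℤ.+ + 2

content-beyond : ∀ xs {t} → length xs ℕ.≤ t → content xs t ≡ 1ℤ ℤ.- + t
content-beyond xs {t} ≤t = ≡.trans (≡.cong (λ x → + x ℤ.- + suc t ℤ.+ + 2) (part-beyond xs ≤t)) (eq (+ t))
  where
  eq : ∀ t → 0ℤ ℤ.- (1ℤ ℤ.+ t) ℤ.+ + 2 ≡ 1ℤ ℤ.- t
  eq = solve-∀

content≤ : ∀ xs t → content xs t ℤ.≤ + suc (total xs)
content≤ xs t = ≡.subst₂ ℤ._≤_ (eq₁ (+ part xs t) (+ t)) (eq₂ (+ total xs))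
  (ℤ.+-monoˡ-≤ 1ℤ (ℤ.≤-trans (i-n≤i (+ part xs t) t) (ℤ.+≤+ (part≤total xs t))))
  where
  eq₁ : ∀ x t → x ℤ.- t ℤ.+ 1ℤ ≡ x ℤ.- (1ℤ ℤ.+ t) ℤ.+ + 2
  eq₁ = solve-∀
  eq₂ : ∀ x → x ℤ.+ 1ℤ ≡ 1ℤ ℤ.+ x
  eq₂ = solve-∀

-- Parts before row `t` are raised by one and keep their position; later parts keep their value and
-- move up one position. Either way value minus position grows by one.
content-strip : ∀ {N} (t : Fin (suc N)) (i : Fin N) xs →
  + part (strip (toℕ t) xs) (toℕ i) ℤ.- + toℕ i ≡ content xs (toℕ (punchIn t i))
content-strip t i xs = ≡.trans (go t i xs) (eq (+ part xs _) (+ _))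
  where
  eq : ∀ x u → x ℤ.- u ℤ.+ 1ℤ ≡ x ℤ.- (1ℤ ℤ.+ u) ℤ.+ + 2
  eq = solve-∀
  eq₀ : ∀ x i → x ℤ.- i ≡ x ℤ.- (1ℤ ℤ.+ i) ℤ.+ 1ℤ
  eq₀ = solve-∀
  eq₁ : ∀ x → 1ℤ ℤ.+ x ℤ.- 0ℤ ≡ x ℤ.- 0ℤ ℤ.+ 1ℤ
  eq₁ = solve-∀
  down : ∀ x i y u → x ℤ.- i ≡ y ℤ.- u ℤ.+ 1ℤ → x ℤ.- (1ℤ ℤ.+ i) ≡ y ℤ.- (1ℤ ℤ.+ u) ℤ.+ 1ℤ
  down x i y u p = ≡.trans (l x i) (≡.trans (≡.cong (ℤ._- 1ℤ) p) (r y u))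
    where
    l : ∀ x i → x ℤ.- (1ℤ ℤ.+ i) ≡ x ℤ.- i ℤ.- 1ℤ
    l = solve-∀
    r : ∀ y u → y ℤ.- u ℤ.+ 1ℤ ℤ.- 1ℤ ≡ y ℤ.- (1ℤ ℤ.+ u) ℤ.+ 1ℤ
    r = solve-∀
  go : ∀ {N} (t : Fin (suc N)) (i : Fin N) xs → + part (strip (toℕ t) xs) (toℕ i) ℤ.- + toℕ i ≡
       + part xs (toℕ (punchIn t i)) ℤ.- + toℕ (punchIn t i) ℤ.+ 1ℤ
  go zero    i       []       = eq₀ 0ℤ (+ toℕ i)
  go zero    i       (x ∷ xs) = eq₀ (+ part xs (toℕ i)) (+ toℕ i)
  go (suc t) zero    []       = ≡.refl
  go (suc t) zero    (x ∷ xs) = eq₁ (+ x)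
  go (suc t) (suc i) []       = down (+ part (strip (toℕ t) []) (toℕ i)) (+ toℕ i)
    0ℤ (+ toℕ (punchIn t i)) (go t i [])
  go (suc t) (suc i) (x ∷ xs) = down (+ part (strip (toℕ t) xs) (toℕ i)) (+ toℕ i)
    (+ part xs (toℕ (punchIn t i))) (+ toℕ (punchIn t i)) (go t i xs)

-- Stability of s_λ, and the delta of ψ* in terms of D⁽⁻ᵖ⁾

module SchurFunctions {c ℓ} (𝐊 : CommutativeRing c ℓ) where
  open Fock 𝐊
  open FamilyProperties 𝐊
  open Polynomials 𝐊 using () renaming (commutativeRing to 𝐁)
  open CommutativeRing 𝐁 hiding (zero) renaming (Carrier to B)
  open SemiringExp semiring using (_^_)
  open SemiringSum semiring using (sum-cong-≋; ∑-comm)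
  open RangeSums +-commutativeMonoid
  open DeterminantProperties 𝐁
  open SetoidReasoning setoid

  ∑-reverse : ∀ N g → ∑ N (λ t → g (N ℕ.∸ suc t)) ≈ ∑ N g
  ∑-reverse zero    g = refl
  ∑-reverse (suc N) g = trans (+-congˡ (∑-reverse N g)) (trans (+-comm _ _) (sym (∑-snoc N g)))

  module _ {h : ℤ → ℤ → B} (isFamily : IsFamily h) where
    open IsFamily isFamily

    -- With the size as a separate argument, vectors of different lengths can be put into
    -- determinants of a common size.
    schur : ℕ → (ℕ → ℤ) → B
    schur N a = det {N} λ i j → h (+ toℕ j) (a (toℕ i) ℤ.- + toℕ i)

    -- A last row belonging to a zero part has the entries `h j (- N)`: zero for j < N and one for j
    -- = N.
    schur-suc : ∀ N a → a N ≡ 0ℤ → schur (suc N) a ≈ schur N a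
    schur-suc N a aN≡0 = trans
      (unit-last-row A
        (λ j → below _ _ (<0-resp (≡.sym (≡.trans last+ (≡.cong (λ j → ℤ.- + N ℤ.+ + j) (toℕ-inject₁ j))))
          (≡.subst (ℤ.- + N ℤ.+ + toℕ j ℤ.<_) (ℤ.+-inverseˡ (+ N)) (ℤ.+-monoʳ-< (ℤ.- + N) (ℤ.+<+ (toℕ<n j))))))
        (diagonal′ isFamily {+ toℕ (fromℕ N)} (≡.trans last+
          (≡.trans (≡.cong (λ j → ℤ.- + N ℤ.+ + j) (toℕ-fromℕ N)) (ℤ.+-inverseˡ (+ N))))))
      (det-cong {N} λ i j → reflexive (≡.cong₂ (λ i j → h (+ j) (a i ℤ.- + i)) (toℕ-inject₁ i) (toℕ-inject₁ j)))
      where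
      A : Fin (suc N) → Fin (suc N) → B
      A i j = h (+ toℕ j) (a (toℕ i) ℤ.- + toℕ i)
      last+ : ∀ {j} → a (toℕ (fromℕ N)) ℤ.- + toℕ (fromℕ N) ℤ.+ j ≡ ℤ.- + N ℤ.+ j
      last+ {j} = ≡.cong (ℤ._+ j) (≡.trans (≡.cong (λ i → a i ℤ.- + i) (toℕ-fromℕ N))
        (≡.trans (≡.cong (ℤ._- + N) aN≡0) (ℤ.+-identityˡ (ℤ.- + N))))

    s-schur : ∀ {N} xs → length xs ℕ.≤ N → s h xs ≈ schur N (entry xs)
    s-schur xs ≤N = go (ℕ.≤⇒≤′ ≤N)
      where
      go : ∀ {N} → length xs ℕ.≤′ N → s h xs ≈ schur N (entry xs)
      go ℕ.≤′-refl = det-cong {length xs} λ i j →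
        reflexive (≡.cong (λ x → h (+ toℕ j) (x ℤ.- + toℕ i)) (≡.sym (entry-lookup xs i)))
      go (ℕ.≤′-step {N} ≤N) = trans (go ≤N)
        (sym (schur-suc N (entry xs) (entry-beyond xs (ℕ.≤′⇒≤ ≤N))))

    s-partition : ∀ {N} xs → length xs ℕ.≤ N → s h (List.map +_ xs) ≈ schur N (λ t → + part xs t)
    s-partition {N} xs ≤N = trans
      (s-schur (List.map +_ xs) (ℕ.≤-trans (ℕ.≤-reflexive (length-map +_ xs)) ≤N))
      (det-cong {N} λ i j → reflexive (≡.cong (λ x → h (+ toℕ j) (x ℤ.- + toℕ i)) (entry-part xs (toℕ i))))

    upper : ℤ → List ℕ → ℕ → B
    upper p xs t = (- 1#) ^ t * h p (content xs t) * s h (List.map +_ (strip t xs))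

    -- This is D⁽ʳ⁾ s_λ = 0 for r ≥ 0.
    ∑-upper-zero : ∀ {N r} xs → length xs ℕ.≤ N → r ℕ.< N → ∑ (suc N) (upper (+ r) xs) ≈ 0#
    ∑-upper-zero {N} {r} xs ≤N r<N = trans
      (sum-cong-≋ {suc N} λ t → *-cong
        (*-congˡ {(- 1#) ^ toℕ t}
          (reflexive (≡.cong (λ r → h (+ r) (content xs (toℕ t))) (≡.sym (toℕ-fromℕ< r<N)))))
        (trans (s-partition (strip (toℕ t) xs) (length-strip xs (ℕ.≤-pred (toℕ<n t)) ≤N))
          (det-cong {N} λ i j → reflexive (≡.cong (h (+ toℕ j)) (content-strip t i xs)))))
      (repeated-column (fromℕ< r<N) (λ t j → h (+ toℕ j) (content xs (toℕ t))))

    -- By `orthogonal`, the delta at row `t` is the sum over p of `h (- p) (content xs t) * E p κ`.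
    -- Exchanging the sums collects the `t`-sum of D⁽⁻ᵖ⁾ s_λ as the factor of `E p κ`, and
    -- `∑-upper-zero` removes all p ≤ 0.
    ∑-upper : ∀ κ xs T Q → suc (length xs ℕ.+ suc ∣ κ ∣) ≡ T → suc (total xs) ℕ.≤ Q →
      ∑ T (λ t → (- 1#) ^ t * δ 0ℤ (content xs t ℤ.+ κ) * s h (List.map +_ (strip t xs))) ≈
      ∑ Q (λ q → E isFamily (+ suc q) κ * ∑ T (upper -[1+ q ] xs))
    ∑-upper κ xs T Q ≡.refl total<Q = begin
      ∑ T (λ t → (- 1#) ^ t * δ 0ℤ (content xs t ℤ.+ κ) * S t)
        ≈⟨ ∑-cong T (λ t → *-congʳ {S t} (*-congˡ {(- 1#) ^ t} (sym
             (orthogonal isFamily (+ Q) (Q ℕ.+ P) (content xs t) κ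
             (ℤ.≤-trans (content≤ xs t) (ℤ.+≤+ total<Q)) bottom<0)))) ⟩
      ∑ T (λ t → (- 1#) ^ t * ∑ (Q ℕ.+ P) (λ i → h (ℤ.- p i) (content xs t) * E′ (p i)) * S t)
        ≈⟨ ∑-cong T (λ t → trans
             (*-congʳ {S t} (∑-*ˡ (Q ℕ.+ P) ((- 1#) ^ t) (λ i → h (ℤ.- p i) (content xs t) * E′ (p i))))
             (trans (∑-*ʳ (Q ℕ.+ P) (S t) (λ i → (- 1#) ^ t * (h (ℤ.- p i) (content xs t) * E′ (p i))))
               (∑-cong (Q ℕ.+ P) λ i → solve 4 (λ c h e s → c :* (h :* e) :* s := e :* (c :* h :* s)) refl
                 ((- 1#) ^ t) (h (ℤ.- p i) (content xs t)) (E′ (p i)) (S t)))) ⟩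
      ∑ T (λ t → ∑ (Q ℕ.+ P) (λ i → E′ (p i) * upper (ℤ.- p i) xs t))
        ≈⟨ ∑-comm {T} {Q ℕ.+ P} (λ t i → E′ (p (toℕ i)) * upper (ℤ.- p (toℕ i)) xs (toℕ t)) ⟩
      ∑ (Q ℕ.+ P) (λ i → ∑ T (λ t → E′ (p i) * upper (ℤ.- p i) xs t))
        ≈⟨ ∑-cong (Q ℕ.+ P) (λ i → sym (∑-*ˡ T (E′ (p i)) (upper (ℤ.- p i) xs))) ⟩
      ∑ (Q ℕ.+ P) (λ i → X (p i))
        ≈⟨ ∑-split Q P (λ i → X (p i)) ⟩
      ∑ Q (λ i → X (p i)) + ∑ P (λ i → X (p (Q ℕ.+ i)))
        ≈⟨ +-cong (∑-cong< Q λ i i<Q → reflexive (≡.cong X (positive i i<Q))) (∑-zero P nonpositive) ⟩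
      ∑ Q (λ i → X (+ suc (Q ℕ.∸ suc i))) + 0#
        ≈⟨ +-identityʳ _ ⟩
      ∑ Q (λ i → X (+ suc (Q ℕ.∸ suc i)))
        ≈⟨ ∑-reverse Q (λ q → X (+ suc q)) ⟩
      ∑ Q (λ q → X (+ suc q)) ∎
      where
      open NaturalSolver commutativeSemiring using (solve; _:=_; _:*_)
      S : ℕ → B
      S t = s h (List.map +_ (strip t xs))
      -- The index p runs through `Q`, ..., 1 and then through the `P` values 0, ..., `- ∣ κ ∣`. It
      -- starts above every content and gets down to `- κ`, as `orthogonal` demands. Every - p of
      -- the second stretch is less than `P`, hence a column of determinants of size
      -- `length xs + P`; this fixes the number `T` of rows.
      P = suc ∣ κ ∣
      E′ : ℤ → B
      E′ p = E isFamily p κ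
      p : ℕ → ℤ
      p i = + Q ℤ.- + i
      X : ℤ → B
      X p = E′ p * ∑ T (upper (ℤ.- p) xs)
      bottom : ∀ κ P Q → κ ℤ.- P ≡ Q ℤ.- (Q ℤ.+ P) ℤ.+ κ
      bottom = solve-∀
      bottom<0 : + Q ℤ.- + (Q ℕ.+ P) ℤ.+ κ ℤ.< 0ℤ
      bottom<0 = <0-resp (bottom κ (+ P) (+ Q)) (i<1+∣i∣ κ)
      positive : ∀ i → i ℕ.< Q → p i ≡ + suc (Q ℕ.∸ suc i)
      positive i i<Q = ≡.trans (ℤ.m-n≡m⊖n Q i) (≡.trans (ℤ.⊖-≥ (ℕ.<⇒≤ i<Q)) (≡.cong +_ (ℕ.+-∸-assoc 1 i<Q)))
      negated : ∀ Q i → ℤ.- (Q ℤ.- (Q ℤ.+ i)) ≡ i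
      negated = solve-∀
      nonpositive : ∀ i → i ℕ.< P → X (p (Q ℕ.+ i)) ≈ 0#
      nonpositive i i<P = trans
        (*-congˡ {E′ (p (Q ℕ.+ i))} (trans
          (∑-cong T λ t → reflexive (≡.cong (λ p → upper p xs t) (negated (+ Q) (+ i))))
          (∑-upper-zero xs (ℕ.m≤m+n (length xs) P) (ℕ.<-≤-trans i<P (ℕ.m≤n+m P (length xs))))))
        (zeroʳ _)

-- Laurent polynomials with coefficients in a module

module LaurentProperties {r ℓr m ℓm} {𝐑 : Ring r ℓr} (M : LeftModule 𝐑 m ℓm) where
  open LeftModule M
  open Laurent M
  private module L = LeftModule leftModule

  single-cong : ∀ n {x y} → x ≈ᴹ y → ((n , x) ∷ []) ≈ᴸ ((n , y) ∷ [])
  single-cong n x≈y k with n ℤ.≟ k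
  ... | yes _ = +ᴹ-congʳ x≈y
  ... | no  _ = ≈ᴹ-refl

  single-+ : ∀ n x y → ((n , x +ᴹ y) ∷ []) ≈ᴸ ((n , x) ∷ (n , y) ∷ [])
  single-+ n x y k with n ℤ.≟ k in eq
  ... | yes _ rewrite eq = +ᴹ-assoc x y 0ᴹ
  ... | no  _ rewrite eq = ≈ᴹ-refl

  single-0 : ∀ n → ((n , 0ᴹ) ∷ []) ≈ᴸ []
  single-0 n k with n ℤ.≟ k
  ... | yes _ = +ᴹ-identityˡ 0ᴹ
  ... | no  _ = ≈ᴹ-refl

  ⊛-constant-zero : ∀ cs {x} → x ≈ᴹ 0ᴹ → (cs ⊛ constant x) ≈ᴸ []
  ⊛-constant-zero []             x≈0 k = ≈ᴹ-refl
  ⊛-constant-zero ((i , c) ∷ cs) x≈0 k with i ℤ.+ 0ℤ ℤ.≟ k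
  ... | yes _ = ≈ᴹ-trans (+ᴹ-cong (≈ᴹ-trans (*ₗ-congˡ x≈0) (*ₗ-zeroʳ c)) (⊛-constant-zero cs x≈0 k))
                  (+ᴹ-identityˡ 0ᴹ)
  ... | no  _ = ⊛-constant-zero cs x≈0 k

  coeff-shift : ∀ d xs k → coeff (shift d xs) k ≈ᴹ coeff xs (k ℤ.- d)
  coeff-shift d []             k = ≈ᴹ-refl
  coeff-shift d ((n , x) ∷ xs) k with d ℤ.+ n ℤ.≟ k | n ℤ.≟ k ℤ.- d
  ... | yes _ | yes _ = +ᴹ-congˡ (coeff-shift d xs k)
  ... | no  _ | no  _ = coeff-shift d xs k
  ... | yes p | no ¬q = contradiction (≡.trans (eq d n) (≡.cong (ℤ._- d) p)) ¬q
    where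
    eq : ∀ d n → n ≡ d ℤ.+ n ℤ.- d
    eq = solve-∀
  ... | no ¬p | yes q = contradiction (≡.trans (≡.cong (λ n → d ℤ.+ n) q) (eq d k)) ¬p
    where
    eq : ∀ d k → d ℤ.+ (k ℤ.- d) ≡ k
    eq = solve-∀

  shift-cong : ∀ d {xs ys} → xs ≈ᴸ ys → shift d xs ≈ᴸ shift d ys
  shift-cong d {xs} {ys} xs≈ys k = ≈ᴹ-trans (coeff-shift d xs k)
    (≈ᴹ-trans (xs≈ys (k ℤ.- d)) (≈ᴹ-sym (coeff-shift d ys k)))

  ⊙-++ : ∀ F xs ys k → (F ⊙ (xs ++ ys)) k ≈ᴹ (F ⊙ xs) k +ᴹ (F ⊙ ys) k
  ⊙-++ F []             ys k = ≈ᴹ-sym (+ᴹ-identityˡ _)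
  ⊙-++ F ((n , x) ∷ xs) ys k = ≈ᴹ-trans (+ᴹ-congˡ (⊙-++ F xs ys k)) (≈ᴹ-sym (+ᴹ-assoc _ _ _))

  open RangeSums +ᴹ-commutativeMonoid using (∑)
  open RangeSums L.+ᴹ-commutativeMonoid using () renaming (∑ to ∑ᴸ)

  ⊙-∑ : ∀ F N ys k → (F ⊙ ∑ᴸ N ys) k ≈ᴹ ∑ N (λ t → (F ⊙ ys t) k)
  ⊙-∑ F zero    ys k = ≈ᴹ-refl
  ⊙-∑ F (suc N) ys k = ≈ᴹ-trans (⊙-++ F (ys 0) (∑ᴸ N (ys ∘ suc)) k) (+ᴹ-congˡ (⊙-∑ F N (ys ∘ suc) k))

-- Linear maps and extension from a spanning family

module Linearity {r ℓr m ℓm v ℓv} {𝐑 : Ring r ℓr} (M : LeftModule 𝐑 m ℓm) (V : LeftModule 𝐑 v ℓv) where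
  private
    module R = Ring 𝐑
    module M = LeftModule M
    module V = LeftModule V
    module ∑M = RangeSums M.+ᴹ-commutativeMonoid
    module ∑V = RangeSums V.+ᴹ-commutativeMonoid

  record IsLinear (f : M.Carrierᴹ → V.Carrierᴹ) : Set (r ⊔ m ⊔ ℓm ⊔ v ⊔ ℓv) where
    field
      cong   : ∀ {x y} → x M.≈ᴹ y → f x V.≈ᴹ f y
      +-homo : ∀ x y → f (x M.+ᴹ y) V.≈ᴹ f x V.+ᴹ f y
      *-homo : ∀ c x → f (c M.*ₗ x) V.≈ᴹ c V.*ₗ f x
      0-homo : f M.0ᴹ V.≈ᴹ V.0ᴹ

    ∑-homo : ∀ N g → f (∑M.∑ N g) V.≈ᴹ ∑V.∑ N (f ∘ g)
    ∑-homo zero    g = 0-homo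
    ∑-homo (suc N) g = V.≈ᴹ-trans (+-homo (g 0) _) (V.+ᴹ-congˡ (∑-homo N (g ∘ suc)))

  open LeftModuleMorphisms M.rawLeftModule V.rawLeftModule using (IsLeftModuleHomomorphism)

  fromHomomorphism : ∀ {f} → IsLeftModuleHomomorphism f → IsLinear f
  fromHomomorphism f-homo = record { cong = ⟦⟧-cong ; +-homo = +ᴹ-homo ; *-homo = *ₗ-homo ; 0-homo = 0ᴹ-homo }
    where open IsLeftModuleHomomorphism f-homo

  zero-linear : IsLinear (λ _ → V.0ᴹ)
  zero-linear = record
    { cong   = λ _ → V.≈ᴹ-refl
    ; +-homo = λ _ _ → V.≈ᴹ-sym (V.+ᴹ-identityˡ V.0ᴹ)
    ; *-homo = λ c _ → V.≈ᴹ-sym (V.*ₗ-zeroʳ c)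
    ; 0-homo = V.≈ᴹ-refl
    }

  module _ {i} {I : Set i} {v : I → M.Carrierᴹ} (size : I → ℕ) where
    open Sums M using (combination)

    bound : List (R.Carrier × I) → ℕ
    bound = List.foldr (λ (_ , i) n → size i ℕ.⊔ n) 0

    -- `G N` stands for the truncation at `N` of an infinite sum, which is correct on `v i` only
    -- from `size i` on. A finite combination has a common bound, so a single truncation serves for
    -- all its terms.
    linear-extension : ∀ {F} {G : ℕ → M.Carrierᴹ → V.Carrierᴹ} → IsLinear F → (∀ N → IsLinear (G N)) →
      (∀ i N → size i ℕ.≤ N → F (v i) V.≈ᴹ G N (v i)) →
      ∀ cs {x} → combination v cs M.≈ᴹ x → ∀ N → bound cs ℕ.≤ N → F x V.≈ᴹ G N x
    linear-extension {F} {G} F-linear G-linear eq cs cs≈x N ≤N =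
      V.≈ᴹ-trans (F.cong (M.≈ᴹ-sym cs≈x)) (V.≈ᴹ-trans (go cs ≤N) (G.cong cs≈x))
      where
      module F = IsLinear F-linear
      module G = IsLinear (G-linear N)
      go : ∀ cs → bound cs ℕ.≤ N → F (combination v cs) V.≈ᴹ G N (combination v cs)
      go []             _  = V.≈ᴹ-trans F.0-homo (V.≈ᴹ-sym G.0-homo)
      go ((c , i) ∷ cs) ≤N = V.≈ᴹ-trans (expand F-linear)
        (V.≈ᴹ-trans (V.+ᴹ-cong
          (V.*ₗ-congˡ (eq i N (ℕ.≤-trans (ℕ.m≤m⊔n (size i) (bound cs)) ≤N)))
          (go cs (ℕ.≤-trans (ℕ.m≤n⊔m (size i) (bound cs)) ≤N)))
        (V.≈ᴹ-sym (expand (G-linear N))))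
        where
        expand : ∀ {f} → IsLinear f →
          f (combination v ((c , i) ∷ cs)) V.≈ᴹ c V.*ₗ f (v i) V.+ᴹ f (combination v cs)
        expand f-linear = V.≈ᴹ-trans (+-homo _ _) (V.+ᴹ-congʳ (*-homo c (v i)))
          where open IsLinear f-linear

∘-linear : ∀ {r ℓr m ℓm v ℓv w ℓw} {𝐑 : Ring r ℓr}
  {M : LeftModule 𝐑 m ℓm} {V : LeftModule 𝐑 v ℓv} {W : LeftModule 𝐑 w ℓw} {f g} →
  Linearity.IsLinear V W g → Linearity.IsLinear M V f → Linearity.IsLinear M W (g ∘ f)
∘-linear {W = W} {f} g-linear f-linear = record
  { cong   = λ p → g.cong (f.cong p)
  ; +-homo = λ x y → W.≈ᴹ-trans (g.cong (f.+-homo x y)) (g.+-homo (f x) (f y))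
  ; *-homo = λ c x → W.≈ᴹ-trans (g.cong (f.*-homo c x)) (g.*-homo c (f x))
  ; 0-homo = W.≈ᴹ-trans (g.cong f.0-homo) g.0-homo
  }
  where
  module W = LeftModule W
  module f = Linearity.IsLinear f-linear
  module g = Linearity.IsLinear g-linear

-- From values on the Schur basis to generating functions

module GeneratingFunctions {c ℓ} (𝐊 : CommutativeRing c ℓ) where
  private module 𝐊 = CommutativeRing 𝐊
  open Fock 𝐊
  open FamilyProperties 𝐊
  open Polynomials 𝐊 using (con; con-+; con-*; con-cong; restrictScalars) renaming (commutativeRing to 𝐁)
  open CommutativeRing 𝐁 hiding (zero) renaming (Carrier to B)
  open RingProperties ring using (-1*x≈-x; +-cancelʳ)
  open CommutativeSemigroupProperties *-commutativeSemigroup using (x∙yz≈y∙xz)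
  open RangeSums +-commutativeMonoid
  open Linearity using (IsLinear)
  open LaurentProperties

  private
    module 𝓑 = LeftModule 𝓑-moduleᴮ
    module ∑𝓑 = RangeSums 𝓑.+ᴹ-commutativeMonoid
    B-moduleᴮ = TensorUnit.leftModule {R = ring}
  open SetoidReasoning 𝓑.≈ᴹ-setoid

  act-++ : ∀ g g′ F k → act (g ++ g′) F k ≈ act g F k + act g′ F k
  act-++ []            g′ F k = sym (+-identityˡ _)
  act-++ ((i , b) ∷ g) g′ F k = trans (+-congˡ (act-++ g g′ F k)) (sym (+-assoc _ _ _))

  act-*ˡ : ∀ g x F k → act g (λ k → x * F k) k ≈ x * act g F k
  act-*ˡ []            x F k = sym (zeroʳ x)
  act-*ˡ ((i , b) ∷ g) x F k = trans
    (+-cong (x∙yz≈y∙xz (con b) x (F (k ℤ.- i))) (act-*ˡ g x F k)) (sym (distribˡ x _ _))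

  con-neg : ∀ b → con (𝐊.- b) ≈ - con b
  con-neg b = +-cancelʳ (con b) _ _ (trans (sym (con-+ (𝐊.- b) b))
    (trans (con-cong (𝐊.-‿inverseˡ b)) (sym (-‿inverseˡ (con b)))))

  act-negate : ∀ g F k → act (K[u].negate g) F k ≈ - 1# * act g F k
  act-negate []            F k = sym (zeroʳ _)
  act-negate ((i , b) ∷ g) F k = trans
    (+-cong
      (trans (*-congʳ (trans (con-neg b) (sym (-1*x≈-x (con b))))) (*-assoc _ _ _))
      (act-negate g F k))
    (sym (distribˡ _ _ _))

  act-⊛ : ∀ g g′ F k → act (g K[u].⊛ g′) F k ≈ act g (act g′ F) k
  act-⊛ []            g′ F k = refl
  act-⊛ ((i , b) ∷ g) g′ F k = trans
    (act-++ (List.map _ g′) (g K[u].⊛ g′) F k)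
    (+-cong (monomial-⊛ g′) (act-⊛ g g′ F k))
    where
    eq : ∀ k i n → k ℤ.- (i ℤ.+ n) ≡ k ℤ.- i ℤ.- n
    eq = solve-∀
    monomial-⊛ : ∀ g′ → act (List.map (λ (n , x) → i ℤ.+ n , b 𝐊.* x) g′) F k ≈ con b * act g′ F (k ℤ.- i)
    monomial-⊛ []             = sym (zeroʳ _)
    monomial-⊛ ((n , x) ∷ g′) = trans
      (+-cong (trans (*-cong (con-* b x) (reflexive (≡.cong F (eq k i n)))) (*-assoc _ _ _)) (monomial-⊛ g′))
      (sym (distribˡ _ _ _))

  -- The left side is the coefficient of uᵏ in g(u)ᵖ F₀(u): a family whose step is multiplication by
  -- `g` consists of the powers of `g` applied to its initial member.
  act-pow : ∀ g (F₀ : ℤ → B) (F : ℕ → ℤ → B) →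
    (∀ k → F₀ k ≈ F 0 k) → (∀ p k → F (suc p) k ≈ act g (F p) k) →
    ∀ p k → act (pow g p) F₀ k ≈ F p k
  act-pow g F₀ F base step zero    k = trans (+-identityʳ _) (trans (*-identityˡ _)
    (trans (reflexive (≡.cong F₀ (ℤ.+-identityʳ k))) (base k)))
  act-pow g F₀ F base step (suc p) k = trans (act-⊛ g (pow g p) F₀ k)
    (trans (act-cong (act (pow g p) F₀) (F p) k k (All.universal (λ _ → tt) g)
      (λ {i} _ → act-pow g F₀ F base step p (k ℤ.- i)))
    (sym (step p k)))

  module _ {n ℓn} (M : LeftModule ring n ℓn) where
    private module M = LeftModule M
    open Laurent M using () renaming (_⊙_ to _⊙ᴹ_)
    open Laurent (restrictScalars M) using (constant) renaming (_⊛_ to _⊛ᴷ_)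

    ⊙-⊛-constant : ∀ F cs x k → (F ⊙ᴹ (cs ⊛ᴷ constant x)) k M.≈ᴹ act cs F k M.*ₗ x
    ⊙-⊛-constant F []             x k = M.≈ᴹ-sym (M.*ₗ-zeroˡ x)
    ⊙-⊛-constant F ((i , c) ∷ cs) x k = M.≈ᴹ-trans
      (M.+ᴹ-cong
        (M.≈ᴹ-trans (M.≈ᴹ-sym (M.*ₗ-assoc _ (con c) x))
          (M.*ₗ-congʳ (trans (*-comm _ _) (*-congˡ (reflexive (≡.cong (λ i → F (k ℤ.- i)) (ℤ.+-identityʳ i)))))))
        (⊙-⊛-constant F cs x k))
      (M.≈ᴹ-sym (M.*ₗ-distribʳ x _ _))

  z^-linear : ∀ m → IsLinear B-moduleᴷ 𝓑-moduleᴷ (_z^ m)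
  z^-linear m = record
    { cong   = λ {x} {y} → single-cong B-moduleᴮ m {x} {y}
    ; +-homo = single-+ B-moduleᴮ m
    ; *-homo = λ c x k → refl
    ; 0-homo = single-0 B-moduleᴮ m
    }

  z^-∑-linear : ∀ {D : ℕ → B → B} (x : ℕ → B) N m → (∀ t → IsLinear B-moduleᴷ B-moduleᴷ (D t)) →
    IsLinear B-moduleᴷ 𝓑-moduleᴷ (λ b → ∑ N (λ t → x t * D t b) z^ m)
  z^-∑-linear {D} x N m D-linear = ∘-linear (z^-linear m) (record
    { cong   = λ p → ∑-cong N λ t → *-congˡ {x t} (D.cong t p)
    ; +-homo = λ b b′ → trans
        (∑-cong N λ t → trans (*-congˡ {x t} (D.+-homo t b b′)) (distribˡ (x t) (D t b) (D t b′)))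
        (∑-+ N (λ t → x t * D t b) (λ t → x t * D t b′))
    ; *-homo = λ c b → trans
        (∑-cong N λ t → trans (*-congˡ {x t} (D.*-homo t c b)) (x∙yz≈y∙xz (x t) (con c) (D t b)))
        (sym (∑-*ˡ N (con c) (λ t → x t * D t b)))
    ; 0-homo = ∑-zero N λ t _ → trans (*-congˡ {x t} (D.0-homo t)) (zeroʳ (x t))
    })
    where
    module D t = IsLinear (D-linear t)

  module _ {h : ℤ → ℤ → B} (basis : HasSchurBasis h) where
    open Sums.IsBasis basis using (spans)

    -- The common form of both formulas. `power t` is the exponent of `g` that goes with the
    -- operator `D t` (`id` for D_p, `suc` for D⁽⁻ᵖ⁾ with p > 0); `size` bounds the operators that
    -- act nontrivially on s_λ; `d` and `e` are the exponents of the prefactor in u and z. The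
    -- coefficients enter only through the recurrence for `F`.
    generating-function :
      ∀ (g : K[u].LPoly) (F₀ : ℤ → B) (F : ℕ → ℤ → B) →
      (∀ k → F₀ k ≈ F 0 k) → (∀ p k → F (suc p) k ≈ act g (F p) k) →
      ∀ (D : ℕ → B → B) (power : ℕ → ℕ) (size : Partition → ℕ) →
      (∀ t → IsLinear B-moduleᴷ B-moduleᴷ (D t)) →
      (∀ λs t → size λs ℕ.≤ t → D t (sᴾ h λs) ≈ 0#) →
      ∀ (Φ : ℤ → B → 𝓑) d e m →
      (∀ k → IsLinear B-moduleᴷ 𝓑-moduleᴷ (Φ k)) →
      (∀ k λs N → size λs ℕ.≤ N →
        Φ k (sᴾ h λs) ≈𝓑 ∑ N (λ t → F (power t) (k ℤ.- d) * D t (sᴾ h λs)) z^ (e ℤ.+ m)) →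
      ∀ b → ∃ λ y →
        Sums.IsSum 𝓑[u].leftModule (λ t → pow g (power t) ⊛ 𝓑[u].constant (D t b z^ m)) y ×
        (λ k → Φ k b) ≈ˢ u^ d · z^ e · F₀ ⊙ y
    generating-function g F₀ F base step D power size D-linear D-vanishes Φ d e m Φ-linear Φ-value b =
      -- Since `y` is the truncated sum itself, the equation in `IsSum` is reflexivity.
      y , (N , vanishes , λ _ _ → refl) , equal
      where
      cs = proj₁ (spans b)
      cs≈b = proj₂ (spans b)
      N = Linearity.bound B-moduleᴷ 𝓑-moduleᴷ {v = sᴾ h} size cs
      summand : ℕ → 𝓑[u].LPoly
      summand t = pow g (power t) ⊛ 𝓑[u].constant (D t b z^ m)
      y = RangeSums.∑ (LeftModule.+ᴹ-commutativeMonoid 𝓑[u].leftModule) N summand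
      vanishes : ∀ t → N ℕ.≤ t → summand t 𝓑[u].≈ᴸ []
      vanishes t N≤t = ⊛-constant-zero 𝓑-moduleᴷ (pow g (power t)) (begin
        D t b z^ m ≈⟨ IsLinear.cong (z^-linear m) Dtb≈0 ⟩
        0# z^ m    ≈⟨ IsLinear.0-homo (z^-linear m) ⟩
        []         ∎)
        where
        Dtb≈0 : D t b ≈ 0#
        -- The zero map is compared with `D t`, the index `t` itself serving as cutoff.
        Dtb≈0 = sym (Linearity.linear-extension B-moduleᴷ B-moduleᴷ size
          (Linearity.zero-linear B-moduleᴷ B-moduleᴷ) D-linear
          (λ λs t ≤t → sym (D-vanishes λs t ≤t)) cs cs≈b t N≤t)
      series : ∀ k → ∑ N (λ t → F (power t) k * D t b) z^ m ≈𝓑 (F₀ ⊙ y) k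
      series k = begin
        ∑ N (λ t → F (power t) k * D t b) z^ m
          ≈⟨ IsLinear.∑-homo (z^-linear m) N (λ t → F (power t) k * D t b) ⟩
        ∑𝓑.∑ N (λ t → F (power t) k *𝓑 (D t b z^ m))
          ≈⟨ ∑𝓑.∑-cong N
               {λ t → act (pow g (power t)) F₀ k *𝓑 (D t b z^ m)} {λ t → F (power t) k *𝓑 (D t b z^ m)}
               (λ t → 𝓑.*ₗ-cong {u = D t b z^ m} {v = D t b z^ m}
                 (act-pow g F₀ F base step (power t) k) (𝓑.≈ᴹ-refl {D t b z^ m})) ⟨
        ∑𝓑.∑ N (λ t → act (pow g (power t)) F₀ k *𝓑 (D t b z^ m))
          ≈⟨ ∑𝓑.∑-cong N {λ t → (F₀ ⊙ summand t) k} {λ t → act (pow g (power t)) F₀ k *𝓑 (D t b z^ m)}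
               (λ t → ⊙-⊛-constant 𝓑-moduleᴮ F₀ (pow g (power t)) (D t b z^ m) k) ⟨
        ∑𝓑.∑ N (λ t → (F₀ ⊙ summand t) k)
          ≈⟨ ⊙-∑ 𝓑-moduleᴮ F₀ N summand k ⟨
        (F₀ ⊙ y) k ∎
      equal : (λ k → Φ k b) ≈ˢ u^ d · z^ e · F₀ ⊙ y
      equal k = begin
        Φ k b
          ≈⟨ Linearity.linear-extension B-moduleᴷ 𝓑-moduleᴷ size (Φ-linear k)
               (λ N → z^-∑-linear {D} (λ t → F (power t) (k ℤ.- d)) N (e ℤ.+ m) D-linear)
               (Φ-value k) cs cs≈b N ℕ.≤-refl ⟩
        ∑ N (λ t → F (power t) (k ℤ.- d) * D t b) z^ (e ℤ.+ m)
          ≈⟨ shift-cong B-moduleᴮ e {∑ N (λ t → F (power t) (k ℤ.- d) * D t b) z^ m} {(F₀ ⊙ y) (k ℤ.- d)}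
               (series (k ℤ.- d)) ⟩
        (u^ d · z^ e · F₀ ⊙ y) k ∎

-- The operators ψ and ψ*

module FermionOperators {c ℓ} (𝐊 : CommutativeRing c ℓ) where
  open Fock 𝐊
  open FamilyProperties 𝐊
  open SchurFunctions 𝐊
  open GeneratingFunctions 𝐊
  open Polynomials 𝐊 using () renaming (commutativeRing to 𝐁)
  open CommutativeRing 𝐁 hiding (zero) renaming (Carrier to B)
  open SemiringExp semiring using (_^_)
  open SemiringSum semiring using (sum-cong-≋)
  open RangeSums +-commutativeMonoid
  open DeterminantProperties 𝐁 using (det; det-cong)
  open Linearity using (IsLinear; fromHomomorphism)

  private
    module 𝓑 = LeftModule 𝓑-moduleᴮ
    module ∑𝓑 = RangeSums 𝓑.+ᴹ-commutativeMonoid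
    module z m = IsLinear (z^-linear m)

  δ-off : ∀ {i} → i ℤ.< 0ℤ → δ 0ℤ i ≈ 0#
  δ-off {i} i<0 with 0ℤ ℤ.≟ i
  ... | yes ≡.refl = contradiction i<0 (ℤ.<-irrefl ≡.refl)
  ... | no  _      = refl

  -- Beyond the length the content is `1 - t`. The threshold is the number of rows in `∑-upper`.
  content-below : ∀ κ xs {t} → suc (length xs ℕ.+ suc ∣ κ ∣) ℕ.≤ t → content xs t ℤ.+ κ ℤ.< 0ℤ
  content-below κ xs {t} ≤t = <0-resp
    (≡.trans (eq κ (+ ∣ κ ∣) (+ t)) (≡.cong (ℤ._+ κ) (≡.sym (content-beyond xs
      (ℕ.≤-trans (ℕ.m≤m+n (length xs) _) (ℕ.≤-trans (ℕ.n≤1+n _) ≤t))))))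
    (ℤ.+-mono-<-≤ (i<1+∣i∣ κ) (ℤ.i≤j⇒i-j≤0 (ℤ.+≤+ (ℕ.≤-trans (ℕ.s≤s (ℕ.m≤n+m (suc ∣ κ ∣) (length xs))) ≤t))))
    where
    eq : ∀ κ a t → κ ℤ.- (1ℤ ℤ.+ a) ℤ.+ ((+ 2 ℤ.+ a) ℤ.- t) ≡ 1ℤ ℤ.- t ℤ.+ κ
    eq = solve-∀

  f≥-1 : ∀ {l+1} (a : Fin l+1 → CommutativeRing.Carrier 𝐊) → All (λ (i , _) → -[1+ 0 ] ℤ.≤ i) (f a)
  f≥-1 a = ℤ.≤-refl ∷ tabulate⁺ λ i → ℤ.-≤+

  module _ {h : ℤ → ℤ → B} (isFamily : IsFamily h) (basis : HasSchurBasis h) where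
    open IsFamily isFamily

    module _ {D : ℤ → B → B} (isLowerD : IsLowerD h D) where
      open IsLowerD isLowerD

      -- Putting `x` in front moves λ down one row, so the minors of the first-row expansion have
      -- the entries `h j (λᵢ - suc i)` that define D_p. The larger range is harmless because D_p
      -- kills s_λ for p beyond the length.
      s-∷ : ∀ x λs N → suc (length (parts λs)) ℕ.≤ N →
        s h (x ∷ List.map +_ (parts λs)) ≈ ∑ N (λ p → (- 1#) ^ p * h (+ p) x * D (+ p) (sᴾ h λs))
      s-∷ x λs N n<N = trans
        (s-schur isFamily (x ∷ List.map +_ xs) (ℕ.s≤s (ℕ.≤-reflexive (length-map +_ xs))))
        (trans
          (sum-cong-≋ {suc n} λ p → *-cong
            (*-congˡ {(- 1#) ^ toℕ p} (reflexive (≡.cong (h (+ toℕ p)) (ℤ.+-identityʳ x))))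
            (trans
              (det-cong {n} λ i j → reflexive (≡.cong (λ x → h (+ toℕ (punchIn p j)) (x ℤ.- + suc (toℕ i)))
                (≡.trans (entry-part xs (toℕ i)) (≡.cong +_ (part-lookup xs i)))))
              (sym (inside λs p))))
          (sym (∑-extend (λ p → (- 1#) ^ p * h (+ p) x * D (+ p) (sᴾ h λs)) n<N (λ p n<p →
            trans (*-congˡ {(- 1#) ^ p * h (+ p) x} (outside′ p n<p)) (zeroʳ _)))))
        where
        xs = parts λs
        n = length xs
        outside′ : ∀ p → n ℕ.< p → D (+ p) (sᴾ h λs) ≈ 0#
        outside′ p n<p = outside λs (+ p) λ (_ , p≤n) → ℕ.<⇒≱ n<p (ℤ.drop‿+≤+ p≤n)

      -- The alternating signs of the row expansion go into the coefficients
      -- `(- 1#) ^ p * h (+ p) k`, which therefore satisfy the recurrence of -f(u).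
      Ψ-formula : ∀ {ψ} → IsPsi h ψ → ∀ {g} → Recurrence g h → ∀ m b →
        ∃ λ y → IsDE D (K[u].negate g) (b z^ m) y ×
          Ψ ψ m b ≈ˢ u^ (m ℤ.+ 1ℤ) · z^ 1ℤ · h (+ 0) ⊙ y
      Ψ-formula {ψ} isPsi {g} recurrence m = generating-function {h} basis
        (K[u].negate g) (h (+ 0)) (λ p k → (- 1#) ^ p * h (+ p) k) (λ k → sym (*-identityˡ _)) step
        (λ p → D (+ p)) id (λ λs → suc (length (parts λs)))
        (λ p → fromHomomorphism B-moduleᴷ B-moduleᴷ (linear (+ p)))
        (λ λs p n<p → outside λs (+ p) λ (_ , p≤n) → ℕ.<⇒≱ n<p (ℤ.drop‿+≤+ p≤n))
        (λ k b → ψ k (b z^ m)) (m ℤ.+ 1ℤ) 1ℤ m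
        (λ k → ∘-linear (fromHomomorphism 𝓑-moduleᴷ 𝓑-moduleᴷ (ψ.linear k)) (z^-linear m))
        value
        where
        module ψ = IsPsi isPsi
        step : ∀ p k → (- 1#) ^ suc p * h (+ suc p) k ≈
                       act (K[u].negate g) (λ k → (- 1#) ^ p * h (+ p) k) k
        step p k = trans (*-assoc _ _ _) (trans
          (*-congˡ (trans (*-congˡ (recurrence (+ suc p) k)) (sym (act-*ˡ g ((- 1#) ^ p) (h (+ p)) k))))
          (sym (act-negate g (λ k → (- 1#) ^ p * h (+ p) k) k)))
        eq : ∀ k m → k ℤ.- m ℤ.- 1ℤ ≡ k ℤ.- (m ℤ.+ 1ℤ)
        eq = solve-∀
        value : ∀ k λs N → suc (length (parts λs)) ℕ.≤ N →
          ψ k (sᴾ h λs z^ m) ≈𝓑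
          ∑ N (λ p → (- 1#) ^ p * h (+ p) (k ℤ.- (m ℤ.+ 1ℤ)) * D (+ p) (sᴾ h λs)) z^ (1ℤ ℤ.+ m)
        value k λs N n<N = begin
          ψ k (sᴾ h λs z^ m)
            ≈⟨ ψ.value k λs m ⟩
          s h (k ℤ.- m ℤ.- 1ℤ ∷ List.map +_ (parts λs)) z^ (m ℤ.+ 1ℤ)
            ≡⟨ ≡.cong₂ (λ k m → s h (k ∷ List.map +_ (parts λs)) z^ m) (eq k m) (ℤ.+-comm m 1ℤ) ⟩
          s h (k ℤ.- (m ℤ.+ 1ℤ) ∷ List.map +_ (parts λs)) z^ (1ℤ ℤ.+ m)
            ≈⟨ z.cong (1ℤ ℤ.+ m) (s-∷ (k ℤ.- (m ℤ.+ 1ℤ)) λs N n<N) ⟩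
          ∑ N (λ p → (- 1#) ^ p * h (+ p) (k ℤ.- (m ℤ.+ 1ℤ)) * D (+ p) (sᴾ h λs)) z^ (1ℤ ℤ.+ m) ∎
          where open SetoidReasoning 𝓑.≈ᴹ-setoid

    module _ {D : ℤ → B → B} (isUpperD : IsUpperD h D) where
      open IsUpperD isUpperD

      -- The definition provides some cutoff only. From `length + 2` on the contents are negative,
      -- so the terms vanish and the sum may be taken over any `T` rows past that point.
      D-∑-upper : ∀ λs q T → suc (suc (length (parts λs))) ℕ.≤ T →
        D -[1+ q ] (sᴾ h λs) ≈ ∑ T (upper isFamily -[1+ q ] (parts λs))
      D-∑-upper λs q T ≤T with value -[1+ q ] λs
      ... | N , vanishes , eq = trans (sym eq) (∑-unique (upper isFamily -[1+ q ] (parts λs)) vanishes vanishes′)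
        where
        xs = parts λs
        vanishes′ : ∀ t → T ℕ.≤ t → upper isFamily -[1+ q ] xs t ≈ 0#
        vanishes′ t T≤t = trans
          (*-congʳ (trans
            (*-congˡ (below -[1+ q ] (content xs t) (ℤ.+-mono-<-≤ {u = -[1+ q ]} {v = 0ℤ} content<0 ℤ.-≤+)))
            (zeroʳ _)))
          (zeroˡ _)
          where
          content<0 : content xs t ℤ.< 0ℤ
          content<0 = <0-resp (ℤ.+-identityʳ _) (content-below 0ℤ xs
            (ℕ.≤-trans (ℕ.≤-reflexive (≡.cong suc (ℕ.+-comm (length xs) 1))) (ℕ.≤-trans ≤T T≤t)))

      -- No content exceeds `suc (total λ)`, so for such `q` every factor `h -[1+ q ]` has a
      -- negative sum of indices.
      D-vanishes : ∀ λs q → suc (total (parts λs)) ℕ.≤ q → D -[1+ q ] (sᴾ h λs) ≈ 0#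
      D-vanishes λs q ≤q with value -[1+ q ] λs
      ... | N , _ , eq = trans (sym eq) (∑-zero N λ t _ → trans
        (*-congʳ {s h (List.map +_ (strip t xs))}
          (trans (*-congˡ {(- 1#) ^ t} (below -[1+ q ] (content xs t) (content<q t))) (zeroʳ _)))
        (zeroˡ _))
        where
        xs = parts λs
        content<q : ∀ t → content xs t ℤ.+ -[1+ q ] ℤ.< 0ℤ
        content<q t = ℤ.≤-<-trans
          (ℤ.+-monoˡ-≤ -[1+ q ] (ℤ.≤-trans (content≤ xs t) (ℤ.+≤+ ≤q)))
          (i<1+∣i∣ (+ q))

      Ψ*-formula : ∀ {ψ*} → IsPsi* h ψ* → ∀ {g} → All (λ (i , _) → -[1+ 0 ] ℤ.≤ i) g → Recurrence g h →
        ∀ m b → ∃ λ y → IsDH⁻¹ D g (b z^ m) y ×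
          Ψ* ψ* m b ≈ˢ u^ (ℤ.- m ℤ.+ 1ℤ) · z^ (ℤ.- 1ℤ) · at-neg-inv (e h (+ 0)) ⊙ y
      Ψ*-formula {ψ*} isPsi* {g} g≥-1 recurrence m = generating-function {h} basis
        g (at-neg-inv (e h (+ 0))) (λ p → E isFamily (+ p))
        -- The coefficient of uᵏ in E(-u⁻¹) is `E 0 k`, up to `0 + k` in the exponent of the sign.
        (λ k → reflexive (≡.cong (λ i → (- 1#) ^ ∣ i ∣ * e h (+ 0) (ℤ.- k)) (≡.sym (ℤ.+-identityˡ k))))
        (λ p k → trans (reflexive (≡.cong (λ p → E isFamily (+ p) k) (ℕ.+-comm 1 p)))
          (E-recurrence isFamily g g≥-1 recurrence (+ p) k))
        (λ q → D -[1+ q ]) suc (λ λs → suc (total (parts λs)))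
        (λ q → fromHomomorphism B-moduleᴷ B-moduleᴷ (linear -[1+ q ]))
        D-vanishes
        (λ k b → ψ* (ℤ.- k) (b z^ m)) (ℤ.- m ℤ.+ 1ℤ) (ℤ.- 1ℤ) m
        (λ k → ∘-linear (fromHomomorphism 𝓑-moduleᴷ 𝓑-moduleᴷ (ψ*.linear (ℤ.- k))) (z^-linear m))
        value*
        where
        module ψ* = IsPsi* isPsi*
        value* : ∀ k λs Q → suc (total (parts λs)) ℕ.≤ Q →
          ψ* (ℤ.- k) (sᴾ h λs z^ m) ≈𝓑
          ∑ Q (λ q → E isFamily (+ suc q) (k ℤ.- (ℤ.- m ℤ.+ 1ℤ)) * D -[1+ q ] (sᴾ h λs)) z^ (ℤ.- 1ℤ ℤ.+ m)
        value* k λs Q total<Q with ψ*.value (ℤ.- k) λs m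
        ... | N , vanishes , eq = begin
          ψ* (ℤ.- k) (sᴾ h λs z^ m)
            ≈⟨ eq ⟨
          ∑𝓑.∑ N (λ t → x t z^ (m ℤ.- 1ℤ))
            ≈⟨ ∑𝓑.∑-unique (λ t → x t z^ (m ℤ.- 1ℤ)) vanishes vanishes′ ⟩
          ∑𝓑.∑ T (λ t → x t z^ (m ℤ.- 1ℤ))
            ≈⟨ z.∑-homo (m ℤ.- 1ℤ) T x ⟨
          ∑ T x z^ (m ℤ.- 1ℤ)
            ≡⟨ ≡.cong (∑ T x z^_) (ℤ.+-comm m (ℤ.- 1ℤ)) ⟩
          ∑ T x z^ (ℤ.- 1ℤ ℤ.+ m)
            ≈⟨ z.cong (ℤ.- 1ℤ ℤ.+ m) (trans
                 (∑-cong T λ t → *-congʳ {S t} (*-congˡ {(- 1#) ^ t} (δ≈ t)))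
                 (trans (∑-upper isFamily κ xs T Q ≡.refl total<Q)
                   (∑-cong Q λ q → *-congˡ {E isFamily (+ suc q) κ} (sym (D-∑-upper λs q T
                     (ℕ.s≤s (ℕ.≤-trans (ℕ.≤-reflexive (ℕ.+-comm 1 (length xs)))
                       (ℕ.+-monoʳ-≤ (length xs) (ℕ.s≤s ℕ.z≤n))))))))) ⟩
          ∑ Q (λ q → E isFamily (+ suc q) κ * D -[1+ q ] (sᴾ h λs)) z^ (ℤ.- 1ℤ ℤ.+ m) ∎
          where
          open SetoidReasoning 𝓑.≈ᴹ-setoid
          xs = parts λs
          -- The exponent that remains after the prefactor `u^(- m + 1)`. In terms of it, the
          -- condition selecting row `t` in ψ* with index `- k` reads `content xs t + κ = 0`; this
          -- is `difference`.
          κ = k ℤ.- (ℤ.- m ℤ.+ 1ℤ)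
          -- From here on the deltas vanish; it is also long enough for `D-∑-upper` and has the form
          -- asked for by `∑-upper`.
          T = suc (length xs ℕ.+ suc ∣ κ ∣)
          S : ℕ → B
          S t = s h (List.map +_ (strip t xs))
          x : ℕ → B
          x t = (- 1#) ^ t * δ (ℤ.- k ℤ.- m ℤ.- 1ℤ) (+ part xs t ℤ.- + suc t) * S t
          difference : ∀ k m a t → ℤ.- k ℤ.- m ℤ.- 1ℤ ℤ.- (a ℤ.- t) ≡
            0ℤ ℤ.- (a ℤ.- t ℤ.+ + 2 ℤ.+ (k ℤ.- (ℤ.- m ℤ.+ 1ℤ)))
          difference = solve-∀
          δ≈ : ∀ t → δ (ℤ.- k ℤ.- m ℤ.- 1ℤ) (+ part xs t ℤ.- + suc t) ≈ δ 0ℤ (content xs t ℤ.+ κ)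
          δ≈ t = δ-cong (difference k m (+ part xs t) (+ suc t))
          vanishes′ : ∀ t → T ℕ.≤ t → x t z^ (m ℤ.- 1ℤ) ≈𝓑 []
          vanishes′ t T≤t = begin
            x t z^ (m ℤ.- 1ℤ) ≈⟨ z.cong (m ℤ.- 1ℤ) (trans
              (*-congʳ {S t} (trans (*-congˡ {(- 1#) ^ t} (trans (δ≈ t) (δ-off (content-below κ xs T≤t)))) (zeroʳ _)))
              (zeroˡ _)) ⟩
            0# z^ (m ℤ.- 1ℤ)  ≈⟨ z.0-homo (m ℤ.- 1ℤ) ⟩
            []                ∎

-- The two formulas over the complex numbers

open import Data.Integer.Base using (-_; _+_)

proposition5p4 :
    let open Fock ℂ-commutativeRing
        open CommutativeRing (Polynomials.commutativeRing ℂ-commutativeRing) using () renaming (Carrier to B)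
    in
    (h : ℤ → ℤ → B) → IsFamily h → HasSchurBasis h →
    (ψ ψ* : ℤ → 𝓑 → 𝓑) → IsPsi h ψ → IsPsi* h ψ* →
    (D↓ D↑ : ℤ → B → B) → IsLowerD h D↓ → IsUpperD h D↑ →
    (l+1 : ℕ) (a : Fin l+1 → ℂ) → Recurrence (f a) h →
    (m : ℤ) →
    (∀ b → ∃ λ y → IsDE D↓ (K[u].negate (f a)) (b z^ m) y ×
      Ψ ψ m b ≈ˢ u^ (m + 1ℤ) · z^ 1ℤ · h (+ 0) ⊙ y)
    ×
    (∀ b → ∃ λ y → IsDH⁻¹ D↑ (f a) (b z^ m) y ×
      Ψ* ψ* m b ≈ˢ u^ (- m + 1ℤ) · z^ (- 1ℤ) · at-neg-inv (e h (+ 0)) ⊙ y)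
proposition5p4 h isFamily basis ψ ψ* isPsi isPsi* D↓ D↑ isLowerD isUpperD l+1 a recurrence m =
    Ψ-formula isFamily basis isLowerD isPsi recurrence m
  , Ψ*-formula isFamily basis isUpperD isPsi* (f≥-1 a) recurrence m
  where
  open Fock ℂ-commutativeRing using (f)
  open FermionOperators ℂ-commutativeRing
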